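{- Let $\tilde f_{n,k}=(x_1+\cdots+x_n)(x_1^2+\cdots+x_n^2)^k\in S^{2k+1}\mathbb{C}^n$. For every $n$, $k$ and $e$ (with $n\ge 1$, $k\ge 0$, $0\le e\le 2k+1$), the flattening $$(\tilde f_{n,k})_{e,2k+1-e}: S^e\mathbb{C}^{n*}\to S^{2k+1-e}\mathbb{C}^n,\qquad D\mapsto D(\tilde f_{n,k}),$$ has full rank, i.e. its rank equals $\min\{\dim S^e\mathbb{C}^{n*},\ \dim S^{2k+1-e}\mathbb{C}^n\}$.
   Context: $S^d\mathbb{C}^n$ denotes the space of homogeneous polynomials of degree $d$ in the variables $x_1,\dots,x_n$ over $\mathbb{C}$, and $S^e\mathbb{C}^{n*}$ the space of homogeneous constant-coefficient differential operators of order $e$ in $\partial/\partial x_1,\dots,\partial/\partial x_n$. For $p\in S^d\mathbb{C}^n$ and $0\le e\le d$, the $e$-th flattening (partial derivative map) of $p$ is $p_{e,d-e}:S^e\mathbb{C}^{n*}\to S^{d-e}\mathbb{C}^n$, $D\mapsto D(p)$. -}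

module Defs where

import Algebra.Definitions.RawMonoid as RawMonoid
open import Algebra.Bundles using (CommutativeRing)
import Algebra.Construct.Pointwise as Pointwise
open import Algebra.Consequences.Setoid using (comm∧idˡ⇒id; comm∧invˡ⇒inv; comm∧distrˡ⇒distr)
open import Algebra.Module.Bundles using (LeftModule)
open import Algebra.Module.Morphism.Structures using (IsLeftModuleHomomorphism)
open import Data.Bool.Base using (if_then_else_)
open import Data.Fin.Base using (Fin; zero; suc)
open import Data.List.Base as List using (List; []; _∷_; foldr; filter; upTo; allFin; cartesianProductWith)
open import Data.List.Membership.Propositional using (_∈_)
open import Data.List.Membership.Propositional.Properties using (∈-cartesianProductWith⁻; ∈-upTo⁻)
open import Data.List.Properties using (map-tabulate)
open import Data.List.Relation.Unary.Any using (here; there)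
open import Data.Nat.Base as ℕ using (ℕ; zero; suc; _∸_; _⊔_; _≤_)
open import Data.Nat.ListAction using () renaming (sum to ℕ-sum)
open import Data.Nat.GeneralisedArithmetic using (fold)
import Data.Nat.Properties as ℕ
open import Data.Product.Base using (Σ; Σ-syntax; ∃-syntax; _×_; _,_; proj₁; proj₂)
open import Data.Rational.Base as ℚ using (ℚ; 0ℚ; 1ℚ; ½)
import Data.Rational.Properties as ℚ
import Data.Rational.Solver as ℚ-Solver
open import Data.Vec.Base as Vec using (Vec; []; _∷_; lookup; replicate; updateAt; zipWith)
open import Data.Vec.Properties using (≡-dec)
open import Function.Base using (_∘_; _on_)
open import Level using (0ℓ) renaming (_⊔_ to _⊔ˡ_; suc to lsuc)
open import Relation.Binary.Bundles using (Setoid)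
open import Relation.Binary.Structures using (IsEquivalence)
open import Relation.Binary.PropositionalEquality
  using (_≡_; _≢_; refl; sym; trans; cong; cong₂; subst; subst₂)
open import Relation.Nullary using (does; yes; no; contradiction)
open import Relation.Unary using (Pred)

private
  ∣a-c∣-split : ∀ a b c → ℚ.∣ a ℚ.- c ∣ ℚ.≤ ℚ.∣ a ℚ.- b ∣ ℚ.+ ℚ.∣ b ℚ.- c ∣
  ∣a-c∣-split a b c = subst (λ z → ℚ.∣ z ∣ ℚ.≤ ℚ.∣ a ℚ.- b ∣ ℚ.+ ℚ.∣ b ℚ.- c ∣)
    (solve 3 (λ a b c → (a :- b) :+ (b :- c) := a :- c) refl a b c)
    (ℚ.∣p+q∣≤∣p∣+∣q∣ (a ℚ.- b) (b ℚ.- c))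
    where open ℚ-Solver.+-*-Solver

  ∣-∣-swap : ∀ a b → ℚ.∣ a ℚ.- b ∣ ≡ ℚ.∣ b ℚ.- a ∣
  ∣-∣-swap a b = trans (sym (ℚ.∣-p∣≡∣p∣ (a ℚ.- b)))
    (cong ℚ.∣_∣ (solve 2 (λ a b → :- (a :- b) := b :- a) refl a b))
    where open ℚ-Solver.+-*-Solver

  0<½* : ∀ {ε} → 0ℚ ℚ.< ε → 0ℚ ℚ.< ½ ℚ.* ε
  0<½* {ε} 0<ε = ℚ.positive⁻¹ (½ ℚ.* ε) {{ℚ.pos*pos⇒pos ½ ε {{ℚ.positive 0<ε}}}}

  ½+½ : ∀ ε → ½ ℚ.* ε ℚ.+ ½ ℚ.* ε ≡ ε
  ½+½ ε = trans (sym (ℚ.*-distribʳ-+ ε ½ ½)) (ℚ.*-identityˡ ε)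

  halves : ∀ {p q r ε} → p ℚ.≤ q ℚ.+ r → q ℚ.< ½ ℚ.* ε → r ℚ.< ½ ℚ.* ε → p ℚ.< ε
  halves {ε = ε} p≤ q< r< = subst (_ ℚ.<_) (½+½ ε) (ℚ.≤-<-trans p≤ (ℚ.+-mono-< q< r<))

  ≡⇒∣-∣< : ∀ {a b ε} → 0ℚ ℚ.< ε → a ≡ b → ℚ.∣ a ℚ.- b ∣ ℚ.< ε
  ≡⇒∣-∣< {a} 0<ε refl = subst (λ z → ℚ.∣ z ∣ ℚ.< _) (sym (ℚ.+-inverseʳ a)) 0<ε

  +-split : ∀ a b c d →
            ℚ.∣ (a ℚ.+ b) ℚ.- (c ℚ.+ d) ∣ ℚ.≤ ℚ.∣ a ℚ.- c ∣ ℚ.+ ℚ.∣ b ℚ.- d ∣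
  +-split a b c d = subst (λ z → ℚ.∣ z ∣ ℚ.≤ ℚ.∣ a ℚ.- c ∣ ℚ.+ ℚ.∣ b ℚ.- d ∣)
    (solve 4 (λ a b c d → (a :- c) :+ (b :- d) := (a :+ b) :- (c :+ d)) refl a b c d)
    (ℚ.∣p+q∣≤∣p∣+∣q∣ (a ℚ.- c) (b ℚ.- d))
    where open ℚ-Solver.+-*-Solver

  neg-split : ∀ a c → ℚ.∣ (ℚ.- a) ℚ.- (ℚ.- c) ∣ ≡ ℚ.∣ a ℚ.- c ∣
  neg-split a c = trans
    (cong ℚ.∣_∣ (solve 2 (λ a c → (:- a) :- (:- c) := :- (a :- c)) refl a c))
    (ℚ.∣-p∣≡∣p∣ (a ℚ.- c))
    where open ℚ-Solver.+-*-Solver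

  *-split : ∀ a b c d → ℚ.∣ (a ℚ.* b) ℚ.- (c ℚ.* d) ∣
                        ℚ.≤ ℚ.∣ a ∣ ℚ.* ℚ.∣ b ℚ.- d ∣ ℚ.+ ℚ.∣ d ∣ ℚ.* ℚ.∣ a ℚ.- c ∣
  *-split a b c d = subst₂ ℚ._≤_
    (cong ℚ.∣_∣ (solve 4 (λ a b c d → a :* (b :- d) :+ d :* (a :- c) := a :* b :- c :* d) refl a b c d))
    (cong₂ ℚ._+_ (ℚ.∣p*q∣≡∣p∣*∣q∣ a (b ℚ.- d)) (ℚ.∣p*q∣≡∣p∣*∣q∣ d (a ℚ.- c)))
    (ℚ.∣p+q∣≤∣p∣+∣q∣ (a ℚ.* (b ℚ.- d)) (d ℚ.* (a ℚ.- c)))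
    where open ℚ-Solver.+-*-Solver

  infixl 7 _÷⁺_
  _÷⁺_ : ∀ ε {B} → 0ℚ ℚ.< B → ℚ
  _÷⁺_ ε {B} 0<B = ε ℚ.* ℚ.1/_ B {{ℚ.pos⇒nonZero B {{ℚ.positive 0<B}}}}

  0<÷⁺ : ∀ {ε B} (0<B : 0ℚ ℚ.< B) → 0ℚ ℚ.< ε → 0ℚ ℚ.< ε ÷⁺ 0<B
  0<÷⁺ {ε} {B} 0<B 0<ε = ℚ.positive⁻¹ (ε ÷⁺ 0<B)
    {{ℚ.pos*pos⇒pos ε {{ℚ.positive 0<ε}} _ {{ℚ.1/pos⇒pos B {{ℚ.positive 0<B}}}}}}

  scaled : ∀ {ε B} (0<B : 0ℚ ℚ.< B) → ∀ {a p} →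
           ℚ.∣ a ∣ ℚ.< B → ℚ.∣ p ∣ ℚ.< ε ÷⁺ 0<B → ℚ.∣ a ∣ ℚ.* ℚ.∣ p ∣ ℚ.< ε
  scaled {ε} {B} 0<B {a} {p} a<B p<δ = ℚ.≤-<-trans
    (ℚ.*-monoʳ-≤-nonNeg ℚ.∣ p ∣ {{ℚ.∣-∣-nonNeg p}} (ℚ.<⇒≤ a<B))
    (subst (B ℚ.* ℚ.∣ p ∣ ℚ.<_) B*δ≡ε (ℚ.*-monoʳ-<-pos B {{ℚ.positive 0<B}} p<δ))
    where
    instance _ = ℚ.pos⇒nonZero B {{ℚ.positive 0<B}}
    B*δ≡ε : B ℚ.* (ε ÷⁺ 0<B) ≡ ε
    B*δ≡ε = trans (ℚ.*-comm B (ε ℚ.* ℚ.1/ B)) (trans (ℚ.*-assoc ε (ℚ.1/ B) B)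
      (trans (cong (ε ℚ.*_) (ℚ.*-inverseˡ B)) (ℚ.*-identityʳ ε)))

-- Cauchy sequences of rationals.  All operations below are termwise, and two
-- sequences are equal when their difference tends to 0.
record ℝ : Set where
  no-eta-equality
  field
    seq    : ℕ → ℚ
    cauchy : ∀ ε → 0ℚ ℚ.< ε →
             ∃[ N ] (∀ m n → N ≤ m → N ≤ n → ℚ.∣ seq m ℚ.- seq n ∣ ℚ.< ε)

open ℝ

infix 4 _≈ℝ_
record _≈ℝ_ (x y : ℝ) : Set where
  constructor mk≈ℝ
  field
    close : ∀ ε → 0ℚ ℚ.< ε → ∃[ N ] (∀ n → N ≤ n → ℚ.∣ seq x n ℚ.- seq y n ∣ ℚ.< ε)

open _≈ℝ_

⊔≤ˡ : ∀ {m n o} → m ⊔ n ≤ o → m ≤ o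
⊔≤ˡ {m} {n} = ℕ.≤-trans (ℕ.m≤m⊔n m n)

⊔≤ʳ : ∀ {m n o} → m ⊔ n ≤ o → n ≤ o
⊔≤ʳ {m} {n} = ℕ.≤-trans (ℕ.m≤n⊔m m n)

pointwise : ∀ {x y} → (∀ n → seq x n ≡ seq y n) → x ≈ℝ y
pointwise eq = mk≈ℝ λ ε 0<ε → 0 , λ n _ → ≡⇒∣-∣< 0<ε (eq n)

≈ℝ-sym : ∀ {x y} → x ≈ℝ y → y ≈ℝ x
≈ℝ-sym {x} {y} x≈y = mk≈ℝ λ ε 0<ε → let N , h = close x≈y ε 0<ε in
  N , λ n N≤n → subst (ℚ._< ε) (∣-∣-swap (seq x n) (seq y n)) (h n N≤n)

≈ℝ-trans : ∀ {x y z} → x ≈ℝ y → y ≈ℝ z → x ≈ℝ z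
≈ℝ-trans {x} {y} {z} x≈y y≈z = mk≈ℝ λ ε 0<ε →
  let M , g = close x≈y (½ ℚ.* ε) (0<½* 0<ε)
      N , h = close y≈z (½ ℚ.* ε) (0<½* 0<ε)
  in M ⊔ N , λ n MN≤n → halves (∣a-c∣-split (seq x n) (seq y n) (seq z n))
                               (g n (⊔≤ˡ MN≤n)) (h n (⊔≤ʳ {M} MN≤n))

bounded : ∀ x → ∃[ B ] (0ℚ ℚ.< B) × ∃[ N ] (∀ n → N ≤ n → ℚ.∣ seq x n ∣ ℚ.< B)
bounded x = B , 0<B , N , bound
  where
  N = proj₁ (cauchy x 1ℚ (ℚ.positive⁻¹ 1ℚ))
  B = 1ℚ ℚ.+ ℚ.∣ seq x N ∣
  0<B : 0ℚ ℚ.< B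
  0<B = ℚ.+-mono-<-≤ (ℚ.positive⁻¹ 1ℚ) (ℚ.0≤∣p∣ (seq x N))
  bound : ∀ n → N ≤ n → ℚ.∣ seq x n ∣ ℚ.< B
  bound n N≤n = ℚ.≤-<-trans
    (subst (λ z → ℚ.∣ z ∣ ℚ.≤ ℚ.∣ seq x n ℚ.- seq x N ∣ ℚ.+ ℚ.∣ seq x N ∣)
      (solve 2 (λ a b → (a :- b) :+ b := a) refl (seq x n) (seq x N))
      (ℚ.∣p+q∣≤∣p∣+∣q∣ (seq x n ℚ.- seq x N) (seq x N)))
    (ℚ.+-mono-<-≤ (proj₂ (cauchy x 1ℚ (ℚ.positive⁻¹ 1ℚ)) n N N≤n ℕ.≤-refl) ℚ.≤-refl)
    where open ℚ-Solver.+-*-Solver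

constℝ : ℚ → ℝ
constℝ q .seq _        = q
constℝ q .cauchy ε 0<ε = 0 , λ _ _ _ _ → ≡⇒∣-∣< {q} 0<ε refl

infixl 6 _+ℝ_
_+ℝ_ : ℝ → ℝ → ℝ
(x +ℝ y) .seq n        = seq x n ℚ.+ seq y n
(x +ℝ y) .cauchy ε 0<ε =
  let M , g = cauchy x (½ ℚ.* ε) (0<½* 0<ε)
      N , h = cauchy y (½ ℚ.* ε) (0<½* 0<ε)
  in M ⊔ N , λ m n ≤m ≤n → halves (+-split (seq x m) (seq y m) (seq x n) (seq y n))
                                  (g m n (⊔≤ˡ ≤m) (⊔≤ˡ ≤n)) (h m n (⊔≤ʳ {M} ≤m) (⊔≤ʳ {M} ≤n))

infix 8 -ℝ_
-ℝ_ : ℝ → ℝ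
(-ℝ x) .seq n        = ℚ.- seq x n
(-ℝ x) .cauchy ε 0<ε = let N , h = cauchy x ε 0<ε in
  N , λ m n ≤m ≤n → subst (ℚ._< ε) (sym (neg-split (seq x m) (seq x n))) (h m n ≤m ≤n)

infixl 7 _*ℝ_
_*ℝ_ : ℝ → ℝ → ℝ
(x *ℝ y) .seq n        = seq x n ℚ.* seq y n
(x *ℝ y) .cauchy ε 0<ε =
  let A , 0<A , K , a = bounded x
      B , 0<B , L , b = bounded y
      M , g = cauchy x (½ ℚ.* ε ÷⁺ 0<B) (0<÷⁺ 0<B (0<½* 0<ε))
      N , h = cauchy y (½ ℚ.* ε ÷⁺ 0<A) (0<÷⁺ 0<A (0<½* 0<ε))
  in (K ⊔ L) ⊔ (M ⊔ N) , λ m n ≤m ≤n →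
     halves (*-split (seq x m) (seq y m) (seq x n) (seq y n))
       (scaled 0<A (a m (⊔≤ˡ (⊔≤ˡ ≤m)))
                   (h m n (⊔≤ʳ {M} (⊔≤ʳ {K ⊔ L} ≤m)) (⊔≤ʳ {M} (⊔≤ʳ {K ⊔ L} ≤n))))
       (scaled 0<B (b n (⊔≤ʳ {K} (⊔≤ˡ ≤n)))
                   (g m n (⊔≤ˡ (⊔≤ʳ {K ⊔ L} ≤m)) (⊔≤ˡ (⊔≤ʳ {K ⊔ L} ≤n))))

+ℝ-cong : ∀ {x x′ y y′} → x ≈ℝ x′ → y ≈ℝ y′ → x +ℝ y ≈ℝ x′ +ℝ y′
+ℝ-cong {x} {x′} {y} {y′} x≈x′ y≈y′ = mk≈ℝ λ ε 0<ε →
  let M , g = close x≈x′ (½ ℚ.* ε) (0<½* 0<ε)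
      N , h = close y≈y′ (½ ℚ.* ε) (0<½* 0<ε)
  in M ⊔ N , λ n ≤n → halves (+-split (seq x n) (seq y n) (seq x′ n) (seq y′ n))
                             (g n (⊔≤ˡ ≤n)) (h n (⊔≤ʳ {M} ≤n))

-ℝ-cong : ∀ {x x′} → x ≈ℝ x′ → -ℝ x ≈ℝ -ℝ x′
-ℝ-cong {x} {x′} x≈x′ = mk≈ℝ λ ε 0<ε → let N , h = close x≈x′ ε 0<ε in
  N , λ n ≤n → subst (ℚ._< ε) (sym (neg-split (seq x n) (seq x′ n))) (h n ≤n)

*ℝ-cong : ∀ {x x′ y y′} → x ≈ℝ x′ → y ≈ℝ y′ → x *ℝ y ≈ℝ x′ *ℝ y′
*ℝ-cong {x} {x′} {y} {y′} x≈x′ y≈y′ = mk≈ℝ λ ε 0<ε →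
  let A , 0<A , K , a = bounded x
      B , 0<B , L , b = bounded y′
      M , g = close x≈x′ (½ ℚ.* ε ÷⁺ 0<B) (0<÷⁺ 0<B (0<½* 0<ε))
      N , h = close y≈y′ (½ ℚ.* ε ÷⁺ 0<A) (0<÷⁺ 0<A (0<½* 0<ε))
  in (K ⊔ L) ⊔ (M ⊔ N) , λ n ≤n →
     halves (*-split (seq x n) (seq y n) (seq x′ n) (seq y′ n))
       (scaled 0<A (a n (⊔≤ˡ (⊔≤ˡ ≤n))) (h n (⊔≤ʳ {M} (⊔≤ʳ {K ⊔ L} ≤n))))
       (scaled 0<B (b n (⊔≤ʳ {K} (⊔≤ˡ ≤n))) (g n (⊔≤ˡ (⊔≤ʳ {K ⊔ L} ≤n))))

0ℝ 1ℝ : ℝ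
0ℝ = constℝ 0ℚ
1ℝ = constℝ 1ℚ

≈ℝ-refl : ∀ {x} → x ≈ℝ x
≈ℝ-refl {x} = pointwise λ _ → refl

+ℝ-assoc : ∀ x y z → (x +ℝ y) +ℝ z ≈ℝ x +ℝ (y +ℝ z)
+ℝ-assoc x y z = pointwise λ n → ℚ.+-assoc (seq x n) (seq y n) (seq z n)

+ℝ-comm : ∀ x y → x +ℝ y ≈ℝ y +ℝ x
+ℝ-comm x y = pointwise λ n → ℚ.+-comm (seq x n) (seq y n)

+ℝ-identityˡ : ∀ x → 0ℝ +ℝ x ≈ℝ x
+ℝ-identityˡ x = pointwise λ n → ℚ.+-identityˡ (seq x n)

+ℝ-inverseˡ : ∀ x → (-ℝ x) +ℝ x ≈ℝ 0ℝ
+ℝ-inverseˡ x = pointwise λ n → ℚ.+-inverseˡ (seq x n)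

*ℝ-assoc : ∀ x y z → (x *ℝ y) *ℝ z ≈ℝ x *ℝ (y *ℝ z)
*ℝ-assoc x y z = pointwise λ n → ℚ.*-assoc (seq x n) (seq y n) (seq z n)

*ℝ-comm : ∀ x y → x *ℝ y ≈ℝ y *ℝ x
*ℝ-comm x y = pointwise λ n → ℚ.*-comm (seq x n) (seq y n)

*ℝ-identityˡ : ∀ x → 1ℝ *ℝ x ≈ℝ x
*ℝ-identityˡ x = pointwise λ n → ℚ.*-identityˡ (seq x n)

*ℝ-distribˡ-+ℝ : ∀ x y z → x *ℝ (y +ℝ z) ≈ℝ (x *ℝ y) +ℝ (x *ℝ z)
*ℝ-distribˡ-+ℝ x y z = pointwise λ n → ℚ.*-distribˡ-+ (seq x n) (seq y n) (seq z n)

≈ℝ-isEquivalence : IsEquivalence _≈ℝ_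
≈ℝ-isEquivalence = record
  { refl = ≈ℝ-refl ; sym = ≈ℝ-sym ; trans = ≈ℝ-trans }

ℝ-commutativeRing : CommutativeRing 0ℓ 0ℓ
ℝ-commutativeRing = record
  { Carrier = ℝ ; _≈_ = _≈ℝ_ ; _+_ = _+ℝ_ ; _*_ = _*ℝ_ ; -_ = -ℝ_ ; 0# = 0ℝ ; 1# = 1ℝ
  ; isCommutativeRing = record
    { isRing = record
      { +-isAbelianGroup = record
        { isGroup = record
          { isMonoid = record
            { isSemigroup = record
              { isMagma = record
                { isEquivalence = ≈ℝ-isEquivalence
                ; ∙-cong = +ℝ-cong
                }
              ; assoc = +ℝ-assoc
              }
            ; identity = comm∧idˡ⇒id ℝ-setoid +ℝ-comm +ℝ-identityˡ
            }
          ; inverse = comm∧invˡ⇒inv ℝ-setoid +ℝ-comm +ℝ-inverseˡ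
          ; ⁻¹-cong = -ℝ-cong
          }
        ; comm = +ℝ-comm
        }
      ; *-cong = *ℝ-cong
      ; *-assoc = *ℝ-assoc
      ; *-identity = comm∧idˡ⇒id ℝ-setoid *ℝ-comm *ℝ-identityˡ
      ; distrib = comm∧distrˡ⇒distr ℝ-setoid +ℝ-cong *ℝ-comm *ℝ-distribˡ-+ℝ
      }
    ; *-comm = *ℝ-comm
    }
  }
  where
  ℝ-setoid : Setoid 0ℓ 0ℓ
  ℝ-setoid = record { isEquivalence = ≈ℝ-isEquivalence }

record ℂ : Set where
  no-eta-equality
  field
    re im : ℝ

open ℂ

infix 4 _≈ℂ_
record _≈ℂ_ (z w : ℂ) : Set where
  constructor mk≈ℂ
  field
    re-≈ : re z ≈ℝ re w
    im-≈ : im z ≈ℝ im w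

infixl 6 _+ℂ_
_+ℂ_ : ℂ → ℂ → ℂ
(z +ℂ w) .re = re z +ℝ re w
(z +ℂ w) .im = im z +ℝ im w

infix 8 -ℂ_
-ℂ_ : ℂ → ℂ
(-ℂ z) .re = -ℝ re z
(-ℂ z) .im = -ℝ im z

infixl 7 _*ℂ_
_*ℂ_ : ℂ → ℂ → ℂ
(z *ℂ w) .re = (re z *ℝ re w) +ℝ (-ℝ (im z *ℝ im w))
(z *ℂ w) .im = (re z *ℝ im w) +ℝ (im z *ℝ re w)

constℂ : ℚ → ℂ
constℂ q .re = constℝ q
constℂ q .im = constℝ 0ℚ

0ℂ 1ℂ : ℂ
0ℂ = constℂ 0ℚ
1ℂ = constℂ 1ℚ

≈ℂ-isEquivalence : IsEquivalence _≈ℂ_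
≈ℂ-isEquivalence = record
  { refl  = mk≈ℂ ≈ℝ-refl ≈ℝ-refl
  ; sym   = λ (mk≈ℂ p q) → mk≈ℂ (≈ℝ-sym p) (≈ℝ-sym q)
  ; trans = λ (mk≈ℂ p q) (mk≈ℂ r s) → mk≈ℂ (≈ℝ-trans p r) (≈ℝ-trans q s)
  }

+ℂ-cong : ∀ {z z′ w w′} → z ≈ℂ z′ → w ≈ℂ w′ → z +ℂ w ≈ℂ z′ +ℂ w′
+ℂ-cong (mk≈ℂ p q) (mk≈ℂ r s) = mk≈ℂ (+ℝ-cong p r) (+ℝ-cong q s)

-ℂ-cong : ∀ {z z′} → z ≈ℂ z′ → -ℂ z ≈ℂ -ℂ z′
-ℂ-cong (mk≈ℂ p q) = mk≈ℂ (-ℝ-cong p) (-ℝ-cong q)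

*ℂ-cong : ∀ {z z′ w w′} → z ≈ℂ z′ → w ≈ℂ w′ → z *ℂ w ≈ℂ z′ *ℂ w′
*ℂ-cong (mk≈ℂ p q) (mk≈ℂ r s) = mk≈ℂ
  (+ℝ-cong (*ℝ-cong p r) (-ℝ-cong (*ℝ-cong q s)))
  (+ℝ-cong (*ℝ-cong p s) (*ℝ-cong q r))

+ℂ-assoc : ∀ x y z → (x +ℂ y) +ℂ z ≈ℂ x +ℂ (y +ℂ z)
+ℂ-assoc x y z = mk≈ℂ (+ℝ-assoc (re x) (re y) (re z)) (+ℝ-assoc (im x) (im y) (im z))

+ℂ-comm : ∀ x y → x +ℂ y ≈ℂ y +ℂ x
+ℂ-comm x y = mk≈ℂ (+ℝ-comm (re x) (re y)) (+ℝ-comm (im x) (im y))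

+ℂ-identityˡ : ∀ x → 0ℂ +ℂ x ≈ℂ x
+ℂ-identityˡ x = mk≈ℂ (+ℝ-identityˡ (re x)) (+ℝ-identityˡ (im x))

+ℂ-inverseˡ : ∀ x → (-ℂ x) +ℂ x ≈ℂ 0ℂ
+ℂ-inverseˡ x = mk≈ℂ (+ℝ-inverseˡ (re x)) (+ℝ-inverseˡ (im x))

module _ where
  open ℚ-Solver.+-*-Solver

  *ℂ-assoc : ∀ x y z → (x *ℂ y) *ℂ z ≈ℂ x *ℂ (y *ℂ z)
  *ℂ-assoc x y z = mk≈ℂ
    (pointwise λ n → solve 6 (λ a b c d e f →
      (a :* c :+ :- (b :* d)) :* e :+ :- ((a :* d :+ b :* c) :* f) :=
      a :* (c :* e :+ :- (d :* f)) :+ :- (b :* (c :* f :+ d :* e))) refl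
      (seq (re x) n) (seq (im x) n) (seq (re y) n) (seq (im y) n) (seq (re z) n) (seq (im z) n))
    (pointwise λ n → solve 6 (λ a b c d e f →
      (a :* c :+ :- (b :* d)) :* f :+ (a :* d :+ b :* c) :* e :=
      a :* (c :* f :+ d :* e) :+ b :* (c :* e :+ :- (d :* f))) refl
      (seq (re x) n) (seq (im x) n) (seq (re y) n) (seq (im y) n) (seq (re z) n) (seq (im z) n))

  *ℂ-comm : ∀ x y → x *ℂ y ≈ℂ y *ℂ x
  *ℂ-comm x y = mk≈ℂ
    (pointwise λ n → solve 4 (λ a b c d → a :* c :+ :- (b :* d) := c :* a :+ :- (d :* b)) refl
      (seq (re x) n) (seq (im x) n) (seq (re y) n) (seq (im y) n))
    (pointwise λ n → solve 4 (λ a b c d → a :* d :+ b :* c := c :* b :+ d :* a) refl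
      (seq (re x) n) (seq (im x) n) (seq (re y) n) (seq (im y) n))

  *ℂ-identityˡ : ∀ x → 1ℂ *ℂ x ≈ℂ x
  *ℂ-identityˡ x = mk≈ℂ
    (pointwise λ n → solve 2 (λ a b → con 1ℚ :* a :+ :- (con 0ℚ :* b) := a) refl
      (seq (re x) n) (seq (im x) n))
    (pointwise λ n → solve 2 (λ a b → con 1ℚ :* b :+ con 0ℚ :* a := b) refl
      (seq (re x) n) (seq (im x) n))

  *ℂ-distribˡ-+ℂ : ∀ x y z → x *ℂ (y +ℂ z) ≈ℂ (x *ℂ y) +ℂ (x *ℂ z)
  *ℂ-distribˡ-+ℂ x y z = mk≈ℂ
    (pointwise λ n → solve 6 (λ a b c d e f →
      a :* (c :+ e) :+ :- (b :* (d :+ f)) :=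
      (a :* c :+ :- (b :* d)) :+ (a :* e :+ :- (b :* f))) refl
      (seq (re x) n) (seq (im x) n) (seq (re y) n) (seq (im y) n) (seq (re z) n) (seq (im z) n))
    (pointwise λ n → solve 6 (λ a b c d e f →
      a :* (d :+ f) :+ b :* (c :+ e) :=
      (a :* d :+ b :* c) :+ (a :* f :+ b :* e)) refl
      (seq (re x) n) (seq (im x) n) (seq (re y) n) (seq (im y) n) (seq (re z) n) (seq (im z) n))

ℂ-commutativeRing : CommutativeRing 0ℓ 0ℓ
ℂ-commutativeRing = record
  { Carrier = ℂ ; _≈_ = _≈ℂ_ ; _+_ = _+ℂ_ ; _*_ = _*ℂ_ ; -_ = -ℂ_ ; 0# = 0ℂ ; 1# = 1ℂ
  ; isCommutativeRing = record
    { isRing = record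
      { +-isAbelianGroup = record
        { isGroup = record
          { isMonoid = record
            { isSemigroup = record
              { isMagma = record { isEquivalence = ≈ℂ-isEquivalence ; ∙-cong = +ℂ-cong }
              ; assoc = +ℂ-assoc
              }
            ; identity = comm∧idˡ⇒id ℂ-setoid +ℂ-comm +ℂ-identityˡ
            }
          ; inverse = comm∧invˡ⇒inv ℂ-setoid +ℂ-comm +ℂ-inverseˡ
          ; ⁻¹-cong = -ℂ-cong
          }
        ; comm = +ℂ-comm
        }
      ; *-cong = *ℂ-cong
      ; *-assoc = *ℂ-assoc
      ; *-identity = comm∧idˡ⇒id ℂ-setoid *ℂ-comm *ℂ-identityˡ
      ; distrib = comm∧distrˡ⇒distr ℂ-setoid +ℂ-cong *ℂ-comm *ℂ-distribˡ-+ℂ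
      }
    ; *-comm = *ℂ-comm
    }
  }
  where
  ℂ-setoid : Setoid 0ℓ 0ℓ
  ℂ-setoid = record { isEquivalence = ≈ℂ-isEquivalence }

-- Used only with K = ℂ; none of the definitions mentions inverses of scalars.
module LinearAlgebra {c ℓ} (K : CommutativeRing c ℓ) where
  open CommutativeRing K using (ring; Carrier; _≈_; 0#)

  VectorSpace : ∀ m ℓm → Set (c ⊔ˡ ℓ ⊔ˡ lsuc (m ⊔ˡ ℓm))
  VectorSpace = LeftModule ring

  module _ {m ℓm} (V : VectorSpace m ℓm) where
    open LeftModule V
    open RawMonoid +ᴹ-rawMonoid using (sum)

    combination : ∀ {r} → (Fin r → Carrier) → (Fin r → Carrierᴹ) → Carrierᴹ
    combination c v = sum (λ i → c i *ₗ v i)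

    LinearlyIndependent : ∀ {r} → (Fin r → Carrierᴹ) → Set (c ⊔ˡ ℓ ⊔ˡ ℓm)
    LinearlyIndependent v = ∀ c → combination c v ≈ᴹ 0ᴹ → ∀ i → c i ≈ 0#

    Spanning : ∀ {r} → (Fin r → Carrierᴹ) → Set (c ⊔ˡ m ⊔ˡ ℓm)
    Spanning v = ∀ x → ∃[ c ] combination c v ≈ᴹ x

    HasDimension : ℕ → Set (c ⊔ˡ ℓ ⊔ˡ m ⊔ˡ ℓm)
    HasDimension r = Σ[ v ∈ (Fin r → Carrierᴹ) ] LinearlyIndependent v × Spanning v

    record IsSubspace {p} (P : Pred Carrierᴹ p) : Set (c ⊔ˡ m ⊔ˡ p) where
      field
        0-closed : P 0ᴹ
        +-closed : ∀ {x y} → P x → P y → P (x +ᴹ y)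
        neg-closed : ∀ {x} → P x → P (-ᴹ x)
        *-closed : ∀ a {x} → P x → P (a *ₗ x)

    subspace : ∀ {p} {P : Pred Carrierᴹ p} → IsSubspace P → VectorSpace (m ⊔ˡ p) ℓm
    subspace {P = P} P-sub = record
      { Carrierᴹ = Σ Carrierᴹ P
      ; _≈ᴹ_ = _≈ᴹ_ on proj₁
      ; _+ᴹ_ = λ (x , px) (y , py) → x +ᴹ y , +-closed px py
      ; _*ₗ_ = λ a (x , px) → a *ₗ x , *-closed a px
      ; 0ᴹ = 0ᴹ , 0-closed
      ; -ᴹ_ = λ (x , px) → -ᴹ x , neg-closed px
      ; isLeftModule = record
        { isLeftSemimodule = record
          { +ᴹ-isCommutativeMonoid = record
            { isMonoid = record
              { isSemigroup = record
                { isMagma = record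
                  { isEquivalence = record { refl = ≈ᴹ-refl ; sym = ≈ᴹ-sym ; trans = ≈ᴹ-trans }
                  ; ∙-cong = +ᴹ-cong
                  }
                ; assoc = λ x y z → +ᴹ-assoc (proj₁ x) (proj₁ y) (proj₁ z)
                }
              ; identity = +ᴹ-identityˡ ∘ proj₁ , +ᴹ-identityʳ ∘ proj₁
              }
            ; comm = λ x y → +ᴹ-comm (proj₁ x) (proj₁ y)
            }
          ; isPreleftSemimodule = record
            { *ₗ-cong = *ₗ-cong
            ; *ₗ-zeroˡ = *ₗ-zeroˡ ∘ proj₁
            ; *ₗ-distribʳ = λ x a b → *ₗ-distribʳ (proj₁ x) a b
            ; *ₗ-identityˡ = *ₗ-identityˡ ∘ proj₁
            ; *ₗ-assoc = λ a b x → *ₗ-assoc a b (proj₁ x)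
            ; *ₗ-zeroʳ = *ₗ-zeroʳ
            ; *ₗ-distribˡ = λ a x y → *ₗ-distribˡ a (proj₁ x) (proj₁ y)
            }
          }
        ; -ᴹ‿cong = -ᴹ‿cong
        ; -ᴹ‿inverse = -ᴹ‿inverseˡ ∘ proj₁ , -ᴹ‿inverseʳ ∘ proj₁
        }
      }
      where open IsSubspace P-sub

  module _ {m ℓm n ℓn} (V : VectorSpace m ℓm) (W : VectorSpace n ℓn) where
    private
      module V = LeftModule V
      module W = LeftModule W

    record LinearMap : Set (c ⊔ˡ m ⊔ˡ ℓm ⊔ˡ n ⊔ˡ ℓn) where
      field
        apply : V.Carrierᴹ → W.Carrierᴹ
        isLinear : IsLeftModuleHomomorphism V.rawLeftModule W.rawLeftModule apply
      open IsLeftModuleHomomorphism isLinear public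

      image-isSubspace : IsSubspace W (λ w → ∃[ v ] apply v W.≈ᴹ w)
      image-isSubspace = record
        { 0-closed = V.0ᴹ , 0ᴹ-homo
        ; +-closed = λ (v , p) (w , q) → v V.+ᴹ w , W.≈ᴹ-trans (+ᴹ-homo v w) (W.+ᴹ-cong p q)
        ; neg-closed = λ (v , p) → V.-ᴹ v , W.≈ᴹ-trans (-ᴹ-homo v) (W.-ᴹ‿cong p)
        ; *-closed = λ a (v , p) → a V.*ₗ v
            , W.≈ᴹ-trans (*ₗ-homo a v) (W.*ₗ-cong (CommutativeRing.refl K) p)
        }

      image : VectorSpace (m ⊔ˡ n ⊔ˡ ℓn) ℓn
      image = subspace W image-isSubspace

      HasRank : ℕ → Set (c ⊔ˡ ℓ ⊔ˡ m ⊔ˡ n ⊔ˡ ℓn)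
      HasRank = HasDimension image

module Polynomials {c ℓ} (K : CommutativeRing c ℓ) where
  open CommutativeRing K renaming (refl to ≈-refl; sym to ≈-sym; trans to ≈-trans)
    hiding (zero)
  open import Algebra.Properties.Ring ring using (-0#≈0#; -‿+-comm; -‿distribˡ-*)
  open RawMonoid +-rawMonoid using () renaming (_×_ to _×′_)
  open LinearAlgebra K

  -- (a₁ , … , aₙ) stands for x₁^a₁ ⋯ xₙ^aₙ.
  Exponent : ℕ → Set
  Exponent = Vec ℕ

  degree : ∀ {n} → Exponent n → ℕ
  degree = Vec.sum

  𝟎 : ∀ {n} → Exponent n
  𝟎 = replicate _ 0

  below : ∀ {n} → Exponent n → List (Exponent n)
  below []      = [] ∷ []
  below (a ∷ α) = cartesianProductWith _∷_ (upTo (suc a)) (below α)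

  exponents : ∀ n d → List (Exponent n)
  exponents n d = filter (λ α → degree α ℕ.≟ d) (below (replicate n d))

  -- The formal power series in n variables.  A homogeneous series of degree d
  -- has finite support, so it is the same thing as a homogeneous polynomial.
  Series : ℕ → Set c
  Series n = Exponent n → Carrier

  SeriesSpace : ℕ → VectorSpace c ℓ
  SeriesSpace n = record
    { Carrierᴹ = Series n
    ; _≈ᴹ_ = λ p q → ∀ α → p α ≈ q α
    ; _+ᴹ_ = λ p q α → p α + q α
    ; _*ₗ_ = λ a p α → a * p α
    ; 0ᴹ = λ _ → 0#
    ; -ᴹ_ = λ p α → - p α
    ; isLeftModule = record
      { isLeftSemimodule = record
        { +ᴹ-isCommutativeMonoid = Pointwise.isCommutativeMonoid (Exponent n) +-isCommutativeMonoid
        ; isPreleftSemimodule = record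
          { *ₗ-cong = λ a≈b p≈q α → *-cong a≈b (p≈q α)
          ; *ₗ-zeroˡ = λ p α → zeroˡ (p α)
          ; *ₗ-distribʳ = λ p a b α → distribʳ (p α) a b
          ; *ₗ-identityˡ = λ p α → *-identityˡ (p α)
          ; *ₗ-assoc = λ a b p α → *-assoc a b (p α)
          ; *ₗ-zeroʳ = λ a α → zeroʳ a
          ; *ₗ-distribˡ = λ a p q α → distribˡ a (p α) (q α)
          }
        }
      ; -ᴹ‿cong = λ p≈q α → -‿cong (p≈q α)
      ; -ᴹ‿inverse = (λ p α → -‿inverseˡ (p α)) , (λ p α → -‿inverseʳ (p α))
      }
    }

  Homogeneous : ∀ {n} → ℕ → Series n → Set ℓ
  Homogeneous d p = ∀ α → degree α ≢ d → p α ≈ 0#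

  homogeneous-isSubspace : ∀ n d → IsSubspace (SeriesSpace n) (Homogeneous d)
  homogeneous-isSubspace n d = record
    { 0-closed = λ _ _ → ≈-refl
    ; +-closed = λ p-hom q-hom α α≢d → ≈-trans (+-cong (p-hom α α≢d) (q-hom α α≢d)) (+-identityˡ 0#)
    ; neg-closed = λ p-hom α α≢d → ≈-trans (-‿cong (p-hom α α≢d)) -0#≈0#
    ; *-closed = λ a p-hom α α≢d → ≈-trans (*-cong ≈-refl (p-hom α α≢d)) (zeroʳ a)
    }

  S : ∀ d n → VectorSpace (c ⊔ˡ ℓ) ℓ
  S d n = subspace (SeriesSpace n) (homogeneous-isSubspace n d)

  -- Homogeneous operators of order e: the coefficient of D at β is that of
  -- ∂₁^β₁ ⋯ ∂ₙ^βₙ.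
  S* : ∀ e n → VectorSpace (c ⊔ˡ ℓ) ℓ
  S* = S

  ∑ : ∀ {a} {A : Set a} → List A → (A → Carrier) → Carrier
  ∑ xs f = foldr (λ x s → f x + s) 0# xs

  monomial : ∀ {n} → Exponent n → Series n
  monomial β α = if does (≡-dec ℕ._≟_ α β) then 1# else 0#

  var : ∀ {n} → Fin n → Series n
  var i = monomial (updateAt 𝟎 i suc)

  infixl 7 _·_
  _·_ : ∀ {n} → Series n → Series n → Series n
  (p · q) γ = ∑ (below γ) (λ α → p α * q (zipWith _∸_ γ α))

  infixr 8 _^_
  _^_ : ∀ {n} → Series n → ℕ → Series n
  p ^ zero  = monomial 𝟎
  p ^ suc k = p · p ^ k

  ∑ᵢ : ∀ {n r} → (Fin r → Series n) → Series n
  ∑ᵢ {n} = RawMonoid.sum (LeftModule.+ᴹ-rawMonoid (SeriesSpace n))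

  -- The coefficient of x^α in ∂p/∂xᵢ is (αᵢ + 1) times that of xᵢ x^α in p.
  ∂ : ∀ {n} → Fin n → Series n → Series n
  ∂ i p α = suc (lookup α i) ×′ p (updateAt α i suc)

  ∂^ : ∀ {n} → Exponent n → Series n → Series n
  ∂^ {n} β p = foldr (λ i q → fold q (∂ i) (lookup β i)) p (allFin n)

  -- D(p) = ∑ D_β ∂^β p over the β of degree e, the order of D.
  differentiate : ∀ {n} e → Series n → Series n → Series n
  differentiate {n} e D p α = ∑ (exponents n e) (λ β → D β * ∂^ β p α)

  ∑-zero : ∀ {a} {A : Set a} (xs : List A) {f} → (∀ {x} → x ∈ xs → f x ≈ 0#) → ∑ xs f ≈ 0#
  ∑-zero []       f≈0 = ≈-refl
  ∑-zero (x ∷ xs) f≈0 =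
    ≈-trans (+-cong (f≈0 (here refl)) (∑-zero xs (f≈0 ∘ there))) (+-identityˡ 0#)

  ∑-cong : ∀ {a} {A : Set a} (xs : List A) {f g} → (∀ x → f x ≈ g x) → ∑ xs f ≈ ∑ xs g
  ∑-cong []       f≈g = ≈-refl
  ∑-cong (x ∷ xs) f≈g = +-cong (f≈g x) (∑-cong xs f≈g)

  ∑-+ : ∀ {a} {A : Set a} (xs : List A) f g → ∑ xs (λ x → f x + g x) ≈ ∑ xs f + ∑ xs g
  ∑-+ []       f g = ≈-sym (+-identityˡ 0#)
  ∑-+ (x ∷ xs) f g = ≈-trans (+-cong ≈-refl (∑-+ xs f g)) (interchange (f x) (g x) (∑ xs f) (∑ xs g))
    where open import Algebra.Properties.CommutativeSemigroup +-commutativeSemigroup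
            using (interchange)

  ∑-neg : ∀ {a} {A : Set a} (xs : List A) f → ∑ xs (λ x → - f x) ≈ - ∑ xs f
  ∑-neg []       f = ≈-sym -0#≈0#
  ∑-neg (x ∷ xs) f = ≈-trans (+-cong ≈-refl (∑-neg xs f)) (-‿+-comm (f x) (∑ xs f))

  ∑-* : ∀ {a} {A : Set a} (xs : List A) b f → ∑ xs (λ x → b * f x) ≈ b * ∑ xs f
  ∑-* []       b f = ≈-sym (zeroʳ b)
  ∑-* (x ∷ xs) b f = ≈-trans (+-cong ≈-refl (∑-* xs b f)) (≈-sym (distribˡ b (f x) (∑ xs f)))

  degree-𝟎 : ∀ n → degree (𝟎 {n}) ≡ 0
  degree-𝟎 zero    = refl
  degree-𝟎 (suc n) = degree-𝟎 n

  degree-suc : ∀ {n} (α : Exponent n) i → degree (updateAt α i suc) ≡ suc (degree α)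
  degree-suc (a ∷ α) zero    = refl
  degree-suc (a ∷ α) (suc i) = trans (cong (a ℕ.+_) (degree-suc α i)) (ℕ.+-suc a (degree α))

  degree-below : ∀ {n} (γ : Exponent n) {α} → α ∈ below γ →
                 degree α ℕ.+ degree (zipWith _∸_ γ α) ≡ degree γ
  degree-below []      (here refl) = refl
  degree-below (c ∷ γ) α∈ with ∈-cartesianProductWith⁻ _∷_ (upTo (suc c)) (below γ) α∈
  ... | a , α , a∈ , α∈′ , refl = trans
    (interchange a (degree α) (c ∸ a) (degree (zipWith _∸_ γ α)))
    (cong₂ ℕ._+_ (ℕ.m+[n∸m]≡n (ℕ.s≤s⁻¹ (∈-upTo⁻ a∈))) (degree-below γ α∈′))
    where open import Algebra.Properties.CommutativeSemigroup ℕ.+-commutativeSemigroup using (interchange)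

  monomial-hom : ∀ {n} (β : Exponent n) → Homogeneous (degree β) (monomial β)
  monomial-hom β α ≢d with ≡-dec ℕ._≟_ α β
  ... | yes refl = contradiction refl ≢d
  ... | no  _    = ≈-refl

  resp-degree : ∀ {n d e} {p : Series n} → d ≡ e → Homogeneous d p → Homogeneous e p
  resp-degree refl p-hom = p-hom

  var-hom : ∀ {n} (i : Fin n) → Homogeneous 1 (var i)
  var-hom {n} i =
    resp-degree {p = var i} (trans (degree-suc 𝟎 i) (cong suc (degree-𝟎 n))) (monomial-hom (updateAt 𝟎 i suc))

  ·-hom : ∀ {n d e} {p q : Series n} → Homogeneous d p → Homogeneous e q → Homogeneous (d ℕ.+ e) (p · q)
  ·-hom {d = d} {e} {p} {q} p-hom q-hom γ ≢d+e = ∑-zero (below γ) term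
    where
    term : ∀ {α} → α ∈ below γ → p α * q (zipWith _∸_ γ α) ≈ 0#
    term {α} α∈ with degree α ℕ.≟ d
    ... | no  ≢d = ≈-trans (*-cong (p-hom α ≢d) ≈-refl) (zeroˡ _)
    ... | yes ≡d = ≈-trans (*-cong ≈-refl (q-hom (zipWith _∸_ γ α)
      λ ≡e → ≢d+e (trans (sym (degree-below γ α∈)) (cong₂ ℕ._+_ ≡d ≡e)))) (zeroʳ _)

  ^-hom : ∀ {n d} {p : Series n} → Homogeneous d p → ∀ k → Homogeneous (k ℕ.* d) (p ^ k)
  ^-hom {n} p-hom zero    = resp-degree {p = monomial 𝟎} (degree-𝟎 n) (monomial-hom (𝟎 {n}))
  ^-hom     p-hom (suc k) = ·-hom p-hom (^-hom p-hom k)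

  ∑ᵢ-hom : ∀ {n d r} {p : Fin r → Series n} → (∀ i → Homogeneous d (p i)) → Homogeneous d (∑ᵢ p)
  ∑ᵢ-hom {r = zero}  p-hom = λ _ _ → ≈-refl
  ∑ᵢ-hom {n} {d} {suc r} p-hom =
    IsSubspace.+-closed (homogeneous-isSubspace n d) (p-hom zero) (∑ᵢ-hom (p-hom ∘ suc))

  ×′-zero : ∀ k {x} → x ≈ 0# → k ×′ x ≈ 0#
  ×′-zero zero    x≈0 = ≈-refl
  ×′-zero (suc k) x≈0 = ≈-trans (+-cong x≈0 (×′-zero k x≈0)) (+-identityˡ 0#)

  Shifted : ∀ {n} → ℕ → ℕ → Series n → Set ℓ
  Shifted d s p = ∀ α → s ℕ.+ degree α ≢ d → p α ≈ 0#

  ∂-shift : ∀ {n d s} {p : Series n} i → Shifted d s p → Shifted d (suc s) (∂ i p)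
  ∂-shift {d = d} {s} i p-shift α ≢d = ×′-zero (suc (lookup α i)) (p-shift (updateAt α i suc)
    λ ≡d → ≢d (trans (sym (trans (cong (s ℕ.+_) (degree-suc α i)) (ℕ.+-suc s (degree α)))) ≡d))

  fold-∂-shift : ∀ {n d s} {p : Series n} i k → Shifted d s p → Shifted d (k ℕ.+ s) (fold p (∂ i) k)
  fold-∂-shift i zero    p-shift = p-shift
  fold-∂-shift {s = s} i (suc k) p-shift = ∂-shift {s = k ℕ.+ s} i (fold-∂-shift i k p-shift)

  sum-lookup : ∀ {n} (β : Exponent n) → ℕ-sum (List.map (lookup β) (allFin n)) ≡ degree β
  sum-lookup β = trans (cong ℕ-sum (map-tabulate (λ i → i) (lookup β))) (sum-tabulate β)
    where
    sum-tabulate : ∀ {n} (β : Exponent n) → ℕ-sum (List.tabulate (lookup β)) ≡ degree β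
    sum-tabulate []      = refl
    sum-tabulate (b ∷ β) = cong (b ℕ.+_) (sum-tabulate β)

  ∂^-shift : ∀ {n d} {p : Series n} β → Homogeneous d p → Shifted d (degree β) (∂^ β p)
  ∂^-shift {n} {d} {p} β p-hom = subst (λ s → Shifted d s (∂^ β p)) (sum-lookup β) (go (allFin n))
    where
    go : ∀ is → Shifted d (ℕ-sum (List.map (lookup β) is))
                          (foldr (λ i q → fold q (∂ i) (lookup β i)) p is)
    go []       = p-hom
    go (i ∷ is) = fold-∂-shift i (lookup β i) (go is)

  differentiate-hom : ∀ {n d} e {D p : Series n} → Homogeneous e D → Homogeneous d p →
                      Homogeneous (d ∸ e) (differentiate e D p)
  differentiate-hom {n} {d} e {D} {p} D-hom p-hom α ≢d∸e = ∑-zero (exponents n e) λ {β} _ → term β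
    where
    term : ∀ β → D β * ∂^ β p α ≈ 0#
    term β with degree β ℕ.≟ e
    ... | no  ≢e = ≈-trans (*-cong (D-hom β ≢e) ≈-refl) (zeroˡ _)
    ... | yes refl = ≈-trans (*-cong ≈-refl (∂^-shift β p-hom α
      λ ≡d → ≢d∸e (trans (sym (ℕ.m+n∸m≡n e (degree α))) (cong (_∸ e) ≡d)))) (zeroʳ _)

  flattening : ∀ {n d} → LeftModule.Carrierᴹ (S d n) → ∀ e → LinearMap (S* e n) (S (d ∸ e) n)
  flattening {n} {d} (p , p-hom) e = record
    { apply = λ (D , D-hom) → differentiate e D p , differentiate-hom e D-hom p-hom
    ; isLinear = record
      { +ᴹ-isGroupHomomorphism = record
        { isMonoidHomomorphism = record
          { isMagmaHomomorphism = record
            { isRelHomomorphism = record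
              { cong = λ D≈E α → ∑-cong βs λ β → *-cong (D≈E β) ≈-refl }
            ; homo = λ (D , _) (E , _) α → ≈-trans
                (∑-cong βs λ β → distribʳ (∂^ β p α) (D β) (E β))
                (∑-+ βs (λ β → D β * ∂^ β p α) (λ β → E β * ∂^ β p α))
            }
          ; ε-homo = λ α → ∑-zero βs λ {β} _ → zeroˡ (∂^ β p α)
          }
        ; ⁻¹-homo = λ (D , _) α → ≈-trans
            (∑-cong βs λ β → ≈-sym (-‿distribˡ-* (D β) (∂^ β p α)))
            (∑-neg βs λ β → D β * ∂^ β p α)
        }
      ; *ₗ-homo = λ a (D , _) α → ≈-trans
          (∑-cong βs λ β → *-assoc a (D β) (∂^ β p α))
          (∑-* βs a λ β → D β * ∂^ β p α)
      }
    }
    where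
    βs : List (Exponent n)
    βs = exponents n e

  f̃-series : ∀ n → ℕ → Series n
  f̃-series n k = ∑ᵢ var · (∑ᵢ λ i → var i ^ 2) ^ k

  f̃ : ∀ n k → LeftModule.Carrierᴹ (S (2 ℕ.* k ℕ.+ 1) n)
  f̃ n k = f̃-series n k , resp-degree {p = f̃-series n k} 1+k*2≡2*k+1
    (·-hom (∑ᵢ-hom {n} var-hom) (^-hom (∑ᵢ-hom {n} λ i → ^-hom (var-hom i) 2) k))
    where
    1+k*2≡2*k+1 : 1 ℕ.+ k ℕ.* 2 ≡ 2 ℕ.* k ℕ.+ 1
    1+k*2≡2*k+1 = trans (ℕ.+-comm 1 (k ℕ.* 2)) (cong (ℕ._+ 1) (ℕ.*-comm k 2))

open LinearAlgebra ℂ-commutativeRing public using (HasDimension; LinearMap)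
open Polynomials ℂ-commutativeRing public using (S; S*; flattening; f̃)

{-# OPTIONS --safe #-}
module Submission where

-- Write q = x₁² + ⋯ + xₙ², ℓ = x₁ + ⋯ + xₙ and G(γ) for the moment of x^γ under n independent
-- Gaussians of variance 2.  Then γ! [x^γ] q^m = m! G(γ) for |γ| = 2m, hence
-- 2 γ! [x^γ] (ℓ q^k) = k! ∑ᵢ G(γ + εᵢ) for |γ| = 2k + 1 (up to scalars, ℓ q^k = (∂₁ + ⋯ + ∂ₙ) q^(k+1)).
-- Expanding monomials in Hermite polynomials, the matrix G(α + β), |α| = |β| = k + 1, is a positive
-- diagonal matrix (the components of top degree) plus a sum of positive multiples of v vᵀ, so it is
-- invertible over ℚ and therefore over ℂ.  As multiplication by ℓ and by powers of x₁ is injective, the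
-- flattenings of order at most k are injective; transposing, those of order at least k + 1 are surjective.

open import Algebra.Bundles using (CommutativeRing)
open import Algebra.Module.Bundles using (LeftModule)
open import Algebra.Morphism.Structures using (IsRingHomomorphism)
open import Data.Fin.Base using (Fin; zero; suc)
open import Data.Fin.Properties using (injective⇒≤)
open import Data.List.Base as List using (List; []; _∷_; _++_; length; foldr; tabulate; filter; upTo; allFin; cartesianProductWith)
open import Data.List.Membership.Propositional using (_∈_)
open import Data.List.Membership.Propositional.Properties
  using (∈-cartesianProductWith⁺; ∈-cartesianProductWith⁻; ∈-upTo⁺; ∈-upTo⁻; ∈-filter⁺; ∈-filter⁻; ∈-lookup; ∈-allFin)
open import Data.List.Properties using (map-tabulate; tabulate-lookup; upTo-∷ʳ)
open import Data.List.Relation.Unary.All as All using ([]; _∷_)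
open import Data.List.Relation.Unary.AllPairs using ([]; _∷_)
open import Data.List.Relation.Unary.Any using (here; there; index)
open import Data.List.Relation.Unary.Any.Properties using (lookup-index)
open import Data.List.Relation.Unary.Unique.Propositional using (Unique)
import Data.List.Relation.Unary.Unique.Propositional.Properties as Unique
open import Data.Nat.Base as ℕ using (ℕ; zero; suc; _∸_; _≤_; _<_; z≤n; s≤s; _!)
open import Data.Nat.GeneralisedArithmetic using (fold)
open import Data.Nat.ListAction using () renaming (sum to ℕ-sum)
import Data.Nat.Properties as ℕ
open import Data.Nat.Solver using (module +-*-Solver)
open import Data.Product.Base using (∃-syntax; _×_; _,_; proj₁; proj₂)
open import Data.Rational.Base as ℚ using (ℚ; 0ℚ; 1ℚ)
import Data.Rational.Properties as ℚ
import Data.Rational.Solver as ℚ-Solver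
open import Data.Sum.Base using (_⊎_; inj₁; inj₂; [_,_]′)
open import Data.Vec.Base using ([]; _∷_; lookup; replicate; updateAt; zipWith)
open import Data.Vec.Properties using (≡-dec; lookup∘updateAt; ∷-injective)
open import Defs using (module LinearAlgebra; module Polynomials)
open import Function.Base using (_∘_; id)
open import Level using (Level)
open import Relation.Binary.PropositionalEquality
  using (_≡_; _≢_; refl; sym; trans; cong; cong₂; subst; module ≡-Reasoning)
open import Relation.Nullary using (yes; no; contradiction; ¬?)
open import Relation.Unary using (Pred; Decidable)

-- Variance 2 is the normalisation that fits q: the moment of order 2a is then (2a)!/a!, so the
-- coefficient formulas need no fractions beyond one factor 2. The matrix of q^(k+1) is chosen
-- because its degree 2(k + 1) is even and gives a square middle matrix, whereas `f̃` has odd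
-- degree; for an operator of order e, the factors ℓ and x₁^(k - e) raise the order to k + 1.
-- Positivity is an argument over an ordered field, and equality of Cauchy sequences is undecidable,
-- so no elimination over ℂ is available. The linear systems are therefore solved explicitly over ℚ,
-- and the solutions, not merely their existence, are carried along a ring homomorphism `ι`. For the
-- same reason the argument is run in dual form: preimages are constructed in the orders from k + 1
-- on, by undoing x₁^(k - e), ℓ and the moment matrix in turn, and injectivity in the complementary
-- order follows by pairing, as the entry at (β, α) depends only on β + α.

-- Hermite expansions and Gaussian moments in one variable

module Hermite where
  open import Data.Nat.Base using (_+_; _*_)
  open +-*-Solver using (solve; _:+_; _:*_; _:=_; con)
  open ≡-Reasoning

  -- x^a = ∑ᵢ coefficient a i · Hᵢ, where the Hermite polynomials Hᵢ satisfy x Hᵢ = Hᵢ₊₁ + 2 i Hᵢ₋₁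
  -- and are orthogonal with E[Hᵢ²] = norm i for the centred Gaussian of variance 2.
  coefficient : ℕ → ℕ → ℕ
  coefficient zero    zero    = 1
  coefficient zero    (suc i) = 0
  coefficient (suc a) zero    = 2 * coefficient a 1
  coefficient (suc a) (suc i) = coefficient a i + 2 * (2 + i) * coefficient a (2 + i)

  norm : ℕ → ℕ
  norm zero    = 1
  norm (suc i) = 2 * suc i * norm i

  -- The mean of x^a: each Hᵢ with i > 0 is orthogonal to H₀ = 1, so only the component at 0
  -- contributes.
  moment : ℕ → ℕ
  moment a = coefficient a 0

  coefficient-above : ∀ {a i} → a < i → coefficient a i ≡ 0
  coefficient-above {zero}  {suc i} _         = refl
  coefficient-above {suc a} {suc i} (s≤s a<i) = cong₂ _+_ (coefficient-above a<i)
    (trans (cong (2 * (2 + i) *_) (coefficient-above (ℕ.<-trans a<i (ℕ.<-trans (ℕ.n<1+n i) (ℕ.n<1+n (suc i))))))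
           (ℕ.*-zeroʳ (2 * (2 + i))))

  coefficient-diagonal : ∀ a → coefficient a a ≡ 1
  coefficient-diagonal zero    = refl
  coefficient-diagonal (suc a) = cong₂ _+_ (coefficient-diagonal a)
    (trans (cong (2 * (2 + a) *_) (coefficient-above {a} {2 + a} (ℕ.<-trans (ℕ.n<1+n a) (ℕ.n<1+n (suc a)))))
           (ℕ.*-zeroʳ (2 * (2 + a))))

  -- Hᵢ₊₁′ = (i + 1) Hᵢ, applied to the expansion of (x^(a+1))′.
  coefficient-derivative : ∀ a i → suc i * coefficient (suc a) (suc i) ≡ suc a * coefficient a i
  coefficient-derivative zero zero    = refl
  coefficient-derivative zero (suc i) =
    trans (cong ((2 + i) *_) (coefficient-above {1} {2 + i} (s≤s (s≤s z≤n)))) (ℕ.*-zeroʳ (2 + i))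
  coefficient-derivative (suc a) zero = begin
    1 * (2 * x + 4 * y)    ≡⟨ solve 2 (λ x y → con 1 :* (con 2 :* x :+ con 4 :* y) := con 2 :* x :+ con 2 :* (con 2 :* y)) refl x y ⟩
    2 * x + 2 * (2 * y)    ≡⟨ cong (λ z → 2 * x + 2 * z) (coefficient-derivative a 1) ⟩
    2 * x + 2 * (suc a * x) ≡⟨ solve 2 (λ a x → con 2 :* x :+ con 2 :* ((con 1 :+ a) :* x) := (con 2 :+ a) :* (con 2 :* x)) refl a x ⟩
    (2 + a) * (2 * x)      ∎
    where
    x = coefficient a 1
    y = coefficient (suc a) 2
  coefficient-derivative (suc a) (suc i) = begin
    (2 + i) * (u + 2 * (3 + i) * v)
      ≡⟨ solve 3 (λ i u v → (con 2 :+ i) :* (u :+ con 2 :* (con 3 :+ i) :* v)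
           := u :+ (con 1 :+ i) :* u :+ con 2 :* (con 2 :+ i) :* ((con 3 :+ i) :* v)) refl i u v ⟩
    u + suc i * u + 2 * (2 + i) * ((3 + i) * v)
      ≡⟨ cong₂ (λ y z → u + y + 2 * (2 + i) * z) (coefficient-derivative a i) (coefficient-derivative a (2 + i)) ⟩
    u + suc a * x + 2 * (2 + i) * (suc a * y)
      ≡⟨ solve 5 (λ a i u x y → u :+ (con 1 :+ a) :* x :+ con 2 :* (con 2 :+ i) :* ((con 1 :+ a) :* y)
           := u :+ (con 1 :+ a) :* (x :+ con 2 :* (con 2 :+ i) :* y)) refl a i u x y ⟩
    (2 + a) * u ∎
    where
    u = coefficient (suc a) (suc i)
    v = coefficient (suc a) (3 + i)
    x = coefficient a i
    y = coefficient a (2 + i)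

  -- Gaussian integration by parts; the factor 2 is the variance.
  moment-step : ∀ a → moment (2 + a) ≡ 2 * suc a * moment a
  moment-step a = begin
    2 * coefficient (suc a) 1       ≡⟨ cong (2 *_) (ℕ.*-identityˡ (coefficient (suc a) 1)) ⟨
    2 * (1 * coefficient (suc a) 1) ≡⟨ cong (2 *_) (coefficient-derivative a 0) ⟩
    2 * (suc a * moment a)          ≡⟨ ℕ.*-assoc 2 (suc a) (moment a) ⟨
    2 * suc a * moment a            ∎

  gramTerm : ℕ → ℕ → ℕ → ℕ
  gramTerm a b i = norm i * (coefficient a i * coefficient b i)

  -- The mean of x^a x^b by orthogonality of the Hᵢ, cut off to the components i < N.
  gram : ℕ → ℕ → ℕ → ℕ
  gram zero    a b = 0
  gram (suc N) a b = gram N a b + gramTerm a b N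

  private
    -- Multiplication by x links only neighbouring Hermite components, with the weight
    -- `norm (suc i)` between i and i + 1 in both directions. This is the resulting tridiagonal
    -- form; its symmetry is the self-adjointness of multiplication by x.
    symmetric : ℕ → ℕ → ℕ → ℕ
    symmetric zero    a b = 0
    symmetric (suc N) a b = symmetric N a b +
      norm (suc N) * (coefficient a N * coefficient b (suc N) + coefficient a (suc N) * coefficient b N)

    symmetric-comm : ∀ N a b → symmetric N a b ≡ symmetric N b a
    symmetric-comm zero    a b = refl
    symmetric-comm (suc N) a b = cong₂ _+_ (symmetric-comm N a b)
      (solve 5 (λ n x y z w → n :* (x :* y :+ z :* w) := n :* (w :* z :+ y :* x)) refl
         (norm (suc N)) (coefficient a N) (coefficient b (suc N)) (coefficient a (suc N)) (coefficient b N))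

    -- The recurrence of `coefficient` pairs up into `symmetric`, except that the cut-off leaves the
    -- link from N + 1 to N without its partner.
    gram-suc : ∀ N a b → gram (suc N) (suc a) b ≡
               symmetric N a b + norm (suc N) * (coefficient a (suc N) * coefficient b N)
    gram-suc zero    a b = solve 2 (λ x y → con 1 :* (con 2 :* x :* y) := con 2 :* (x :* y)) refl
                             (coefficient a 1) (coefficient b 0)
    gram-suc (suc N) a b = begin
      gram (suc N) (suc a) b + c * ((x + 2 * (2 + N) * z) * w)
        ≡⟨ cong (_+ c * ((x + 2 * (2 + N) * z) * w)) (gram-suc N a b) ⟩
      s + c * (y * v) + c * ((x + 2 * (2 + N) * z) * w)
        ≡⟨ solve 8 (λ N s c x y z v w →
             s :+ c :* (y :* v) :+ c :* ((x :+ con 2 :* (con 2 :+ N) :* z) :* w) :=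
             s :+ c :* (x :* w :+ y :* v) :+ con 2 :* (con 2 :+ N) :* c :* (z :* w)) refl N s c x y z v w ⟩
      s + c * (x * w + y * v) + 2 * (2 + N) * c * (z * w) ∎
      where
      s = symmetric N a b
      c = norm (suc N)
      x = coefficient a N
      y = coefficient a (suc N)
      z = coefficient a (2 + N)
      v = coefficient b N
      w = coefficient b (suc N)

    gram-zero : ∀ N b → gram (suc N) 0 b ≡ moment b
    gram-zero zero    b = solve 1 (λ x → con 1 :* (con 1 :* x) := x) refl (moment b)
    gram-zero (suc N) b = trans (cong₂ _+_ (gram-zero N b) (ℕ.*-zeroʳ (norm (suc N)))) (ℕ.+-identityʳ (moment b))

    -- Self-adjointness of multiplication by x. The unpaired terms on the two sides contain
    -- `coefficient a (suc N)` and `coefficient a N`, and both vanish because a < N.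
    gram-shift : ∀ N a b → suc a ≤ N → gram (suc N) (suc a) b ≡ gram (suc N) a (suc b)
    gram-shift N a b a<N = begin
      gram (suc N) (suc a) b ≡⟨ gram-suc N a b ⟩
      symmetric N a b + norm (suc N) * (coefficient a (suc N) * coefficient b N)
        ≡⟨ cong₂ _+_ (symmetric-comm N a b) (cong (norm (suc N) *_)
             (trans (cong (_* coefficient b N) (coefficient-above {a} (ℕ.m<n⇒m<1+n a<N)))
                    (sym (trans (cong (coefficient b (suc N) *_) (coefficient-above {a} a<N))
                                (ℕ.*-zeroʳ (coefficient b (suc N))))))) ⟩
      symmetric N b a + norm (suc N) * (coefficient b (suc N) * coefficient a N) ≡⟨ gram-suc N b a ⟨
      gram (suc N) (suc b) a ≡⟨ gram-comm (suc N) (suc b) a ⟩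
      gram (suc N) a (suc b) ∎
      where
      gram-comm : ∀ N a b → gram N a b ≡ gram N b a
      gram-comm zero    a b = refl
      gram-comm (suc N) a b = cong₂ _+_ (gram-comm N a b)
        (cong (norm N *_) (ℕ.*-comm (coefficient a N) (coefficient b N)))

  -- The factors x move one at a time from the left argument to the right one, until the left is 1 =
  -- H₀ and selects the component at 0.
  gram≡moment : ∀ {N} a b → a ≤ N → gram (suc N) a b ≡ moment (a + b)
  gram≡moment {N} zero    b _   = gram-zero N b
  gram≡moment {N} (suc a) b a<N = trans (gram-shift N a b a<N)
    (trans (gram≡moment a (suc b) (ℕ.<⇒≤ a<N)) (cong moment (ℕ.+-suc a b)))

-- Finite sums and natural numbers as scalars

module Sums {c ℓ} (K : CommutativeRing c ℓ) where
  open CommutativeRing K renaming (refl to ≈-refl; sym to ≈-sym; trans to ≈-trans) hiding (zero)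
  open Polynomials K using (∑; ∑-zero; ∑-+)
  open import Algebra.Properties.Semiring.Mult semiring using (×-homo-+; ×1-homo-*) renaming (_×_ to _×′_)
  open import Algebra.Properties.CommutativeSemigroup +-commutativeSemigroup using (x∙yz≈y∙xz)

  private variable
    i j k : Level
    A : Set i
    B : Set j
    C : Set k

  cast : ℕ → Carrier
  cast n = n ×′ 1#

  cast-≡ : ∀ {m n} → m ≡ n → cast m ≈ cast n
  cast-≡ refl = ≈-refl

  cast-+ : ∀ m n → cast (m ℕ.+ n) ≈ cast m + cast n
  cast-+ = ×-homo-+ 1#

  cast-* : ∀ m n → cast (m ℕ.* n) ≈ cast m * cast n
  cast-* = ×1-homo-*

  ∑-cong∈ : ∀ (xs : List A) {f g} → (∀ {x} → x ∈ xs → f x ≈ g x) → ∑ xs f ≈ ∑ xs g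
  ∑-cong∈ []       f≈g = ≈-refl
  ∑-cong∈ (x ∷ xs) f≈g = +-cong (f≈g (here refl)) (∑-cong∈ xs (f≈g ∘ there))

  ∑-swap : ∀ (xs : List A) (ys : List B) (f : A → B → Carrier) → ∑ xs (λ x → ∑ ys (f x)) ≈ ∑ ys (λ y → ∑ xs (λ x → f x y))
  ∑-swap []       ys f = ≈-sym (∑-zero ys λ _ → ≈-refl)
  ∑-swap (x ∷ xs) ys f =
    ≈-trans (+-congˡ (∑-swap xs ys f)) (≈-sym (∑-+ ys (f x) (λ y → ∑ xs (λ x → f x y))))

  ∑-*ʳ : ∀ (xs : List A) f b → ∑ xs (λ x → f x * b) ≈ ∑ xs f * b
  ∑-*ʳ []       f b = ≈-sym (zeroˡ b)
  ∑-*ʳ (x ∷ xs) f b = ≈-trans (+-congˡ (∑-*ʳ xs f b)) (≈-sym (distribʳ b (f x) (∑ xs f)))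

  ∑-++ : ∀ (xs ys : List A) f → ∑ (xs ++ ys) f ≈ ∑ xs f + ∑ ys f
  ∑-++ []       ys f = ≈-sym (+-identityˡ (∑ ys f))
  ∑-++ (x ∷ xs) ys f = ≈-trans (+-congˡ (∑-++ xs ys f)) (≈-sym (+-assoc (f x) (∑ xs f) (∑ ys f)))

  ∑-map : ∀ (g : A → B) xs f → ∑ (List.map g xs) f ≈ ∑ xs (f ∘ g)
  ∑-map g []       f = ≈-refl
  ∑-map g (x ∷ xs) f = +-congˡ (∑-map g xs f)

  ∑-cartesianProductWith : ∀ (g : A → B → C) xs ys (f : C → Carrier) →
    ∑ (cartesianProductWith g xs ys) f ≈ ∑ xs (λ x → ∑ ys (λ y → f (g x y)))
  ∑-cartesianProductWith g []       ys f = ≈-refl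
  ∑-cartesianProductWith g (x ∷ xs) ys f = ≈-trans
    (∑-++ (List.map (g x) ys) (cartesianProductWith g xs ys) f)
    (+-cong (∑-map (g x) ys f) (∑-cartesianProductWith g xs ys f))

  ∑-filter : ∀ {p} {P : Pred A p} (P? : Decidable P) xs f →
             ∑ xs f ≈ ∑ (filter P? xs) f + ∑ (filter (¬? ∘ P?) xs) f
  ∑-filter P? []       f = ≈-sym (+-identityˡ 0#)
  ∑-filter P? (x ∷ xs) f with P? x
  ... | yes _ = ≈-trans (+-congˡ (∑-filter P? xs f)) (≈-sym (+-assoc (f x) _ _))
  ... | no  _ = ≈-trans (+-congˡ (∑-filter P? xs f)) (x∙yz≈y∙xz (f x) _ _)

  ∑-single : ∀ {xs : List A} {a f} → Unique xs → a ∈ xs → (∀ x → x ∈ xs → x ≢ a → f x ≈ 0#) → ∑ xs f ≈ f a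
  ∑-single {xs = x ∷ xs} {f = f} (x∉ ∷ _) (here refl) f≈0 = ≈-trans
    (+-congˡ (∑-zero xs λ {y} y∈ → f≈0 y (there y∈) λ y≡x → All.lookup x∉ y∈ (sym y≡x))) (+-identityʳ (f x))
  ∑-single {xs = x ∷ xs} (x∉ ∷ uniq) (there a∈) f≈0 = ≈-trans
    (+-cong (f≈0 x (here refl) λ x≡a → All.lookup x∉ a∈ x≡a) (∑-single uniq a∈ λ y y∈ → f≈0 y (there y∈))) (+-identityˡ _)

  ∑-cast : ∀ (xs : List A) f → ∑ xs (cast ∘ f) ≈ cast (ℕ-sum (List.map f xs))
  ∑-cast []       f = ≈-refl
  ∑-cast (x ∷ xs) f = ≈-trans (+-congˡ (∑-cast xs f)) (≈-sym (cast-+ (f x) (ℕ-sum (List.map f xs))))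

-- Exponent vectors, and factorials and moments as products over the variables

module Exponents {c ℓ} (K : CommutativeRing c ℓ) where
  open Polynomials K using (Exponent; degree; 𝟎; below; exponents)

  infixl 6 _⊕_
  _⊕_ : ∀ {n} → Exponent n → Exponent n → Exponent n
  _⊕_ = zipWith ℕ._+_

  degree-⊕ : ∀ {n} (α β : Exponent n) → degree (α ⊕ β) ≡ degree α ℕ.+ degree β
  degree-⊕ []      []      = refl
  degree-⊕ (a ∷ α) (b ∷ β) = trans (cong (a ℕ.+ b ℕ.+_) (degree-⊕ α β)) (interchange a b (degree α) (degree β))
    where open import Algebra.Properties.CommutativeSemigroup ℕ.+-commutativeSemigroup using (interchange)

  below-unique : ∀ {n} (γ : Exponent n) → Unique (below γ)
  below-unique []      = [] ∷ []
  below-unique (c ∷ γ) = Unique.cartesianProductWith⁺ _∷_ ∷-injective (Unique.upTo⁺ (suc c)) (below-unique γ)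

  exponents-unique : ∀ n d → Unique (exponents n d)
  exponents-unique n d = Unique.filter⁺ (λ α → degree α ℕ.≟ d) (below-unique (replicate n d))

  ∈-below-⊕ : ∀ {n} (β γ : Exponent n) → β ∈ below (β ⊕ γ)
  ∈-below-⊕ []      []      = here refl
  ∈-below-⊕ (b ∷ β) (c ∷ γ) = ∈-cartesianProductWith⁺ _∷_ (∈-upTo⁺ (s≤s (ℕ.m≤m+n b c))) (∈-below-⊕ β γ)

  ⊕-∸-below : ∀ {n} (γ : Exponent n) {α} → α ∈ below γ → α ⊕ zipWith _∸_ γ α ≡ γ
  ⊕-∸-below []      (here refl) = refl
  ⊕-∸-below (c ∷ γ) α∈ with ∈-cartesianProductWith⁻ _∷_ (upTo (suc c)) (below γ) α∈
  ... | a , α , a∈ , α∈′ , refl = cong₂ _∷_ (ℕ.m+[n∸m]≡n (ℕ.s≤s⁻¹ (∈-upTo⁻ a∈))) (⊕-∸-below γ α∈′)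

  ∈-below-replicate : ∀ {n d} (α : Exponent n) → degree α ≤ d → α ∈ below (replicate n d)
  ∈-below-replicate []      _  = here refl
  ∈-below-replicate (a ∷ α) ≤d = ∈-cartesianProductWith⁺ _∷_
    (∈-upTo⁺ (s≤s (ℕ.≤-trans (ℕ.m≤m+n a (degree α)) ≤d)))
    (∈-below-replicate α (ℕ.≤-trans (ℕ.m≤n+m (degree α) a) ≤d))

  ∈-exponents⁺ : ∀ {n d} {α : Exponent n} → degree α ≡ d → α ∈ exponents n d
  ∈-exponents⁺ {α = α} refl = ∈-filter⁺ (λ β → degree β ℕ.≟ degree α) (∈-below-replicate α ℕ.≤-refl) refl

  ∈-exponents⁻ : ∀ {n d} {α : Exponent n} → α ∈ exponents n d → degree α ≡ d
  ∈-exponents⁻ {n} {d} α∈ = proj₂ (∈-filter⁻ (λ β → degree β ℕ.≟ d) {xs = below (replicate n d)} α∈)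

  degree-0 : ∀ {n} (α : Exponent n) → degree α ≡ 0 → α ≡ 𝟎
  degree-0 []         _  = refl
  degree-0 (zero ∷ α) ≡0 = cong (0 ∷_) (degree-0 α ≡0)

  𝟎⊕ : ∀ {n} (γ : Exponent n) → 𝟎 ⊕ γ ≡ γ
  𝟎⊕ []      = refl
  𝟎⊕ (c ∷ γ) = cong (c ∷_) (𝟎⊕ γ)

  ε⊕ : ∀ {n} i (γ : Exponent n) → updateAt 𝟎 i suc ⊕ γ ≡ updateAt γ i suc
  ε⊕ zero    (c ∷ γ) = cong (suc c ∷_) (𝟎⊕ γ)
  ε⊕ (suc i) (c ∷ γ) = cong (c ∷_) (ε⊕ i γ)

  ⊕-updateAt : ∀ {n} i (β γ : Exponent n) → updateAt β i suc ⊕ γ ≡ updateAt (β ⊕ γ) i suc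
  ⊕-updateAt zero    (b ∷ β) (c ∷ γ) = refl
  ⊕-updateAt (suc i) (b ∷ β) (c ∷ γ) = cong (b ℕ.+ c ∷_) (⊕-updateAt i β γ)

  updateAt-⊕ : ∀ {n} i (β γ : Exponent n) → updateAt (β ⊕ γ) i suc ≡ β ⊕ updateAt γ i suc
  updateAt-⊕ zero    (b ∷ β) (c ∷ γ) = cong (_∷ β ⊕ γ) (sym (ℕ.+-suc b c))
  updateAt-⊕ (suc i) (b ∷ β) (c ∷ γ) = cong (b ℕ.+ c ∷_) (updateAt-⊕ i β γ)

  ⊕-comm : ∀ {n} (β γ : Exponent n) → β ⊕ γ ≡ γ ⊕ β
  ⊕-comm []      []      = refl
  ⊕-comm (b ∷ β) (c ∷ γ) = cong₂ _∷_ (ℕ.+-comm b c) (⊕-comm β γ)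

  lower : ∀ {n} i (γ : Exponent n) → lookup γ i ≡ 0 ⊎ ∃[ β ] updateAt β i suc ≡ γ
  lower zero    (zero  ∷ γ) = inj₁ refl
  lower zero    (suc c ∷ γ) = inj₂ (c ∷ γ , refl)
  lower (suc i) (c ∷ γ) with lower i γ
  ... | inj₁ ≡0         = inj₁ ≡0
  ... | inj₂ (β , refl) = inj₂ (c ∷ β , refl)

  updateAt-suc-injective : ∀ {n} i {α β : Exponent n} → updateAt α i suc ≡ updateAt β i suc → α ≡ β
  updateAt-suc-injective zero    {_ ∷ _} {_ ∷ _} refl = refl
  updateAt-suc-injective (suc i) {_ ∷ _} {_ ∷ _} eq with ∷-injective eq
  ... | refl , eq′ = cong (_ ∷_) (updateAt-suc-injective i eq′)

  ∏ : ∀ {n} → (ℕ → ℕ) → Exponent n → ℕ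
  ∏ f []      = 1
  ∏ f (a ∷ α) = f a ℕ.* ∏ f α

  ∏-𝟎 : ∀ n {f} → f 0 ≡ 1 → ∏ f (𝟎 {n}) ≡ 1
  ∏-𝟎 zero    f0≡1 = refl
  ∏-𝟎 (suc n) f0≡1 = cong₂ ℕ._*_ f0≡1 (∏-𝟎 n f0≡1)

  ∏-updateAt : ∀ {n} {f g h : ℕ → ℕ} i (α : Exponent n) → (∀ a → f (g a) ≡ h a ℕ.* f a) →
               ∏ f (updateAt α i g) ≡ h (lookup α i) ℕ.* ∏ f α
  ∏-updateAt {f = f} {g} {h} zero (a ∷ α) eq =
    trans (cong (ℕ._* ∏ f α) (eq a)) (ℕ.*-assoc (h a) (f a) (∏ f α))
  ∏-updateAt {f = f} {g} {h} (suc i) (a ∷ α) eq =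
    trans (cong (f a ℕ.*_) (∏-updateAt {g = g} {h} i α eq)) (x∙yz≈y∙xz (f a) (h (lookup α i)) (∏ f α))
    where open import Algebra.Properties.CommutativeSemigroup ℕ.*-commutativeSemigroup using (x∙yz≈y∙xz)

  ∏-lookup-0 : ∀ {n f} i (α : Exponent n) → f (lookup α i) ≡ 0 → ∏ f α ≡ 0
  ∏-lookup-0 {f = f} zero    (a ∷ α) f≡0 = cong (ℕ._* ∏ f α) f≡0
  ∏-lookup-0 {f = f} (suc i) (a ∷ α) f≡0 =
    trans (cong (f a ℕ.*_) (∏-lookup-0 i α f≡0)) (ℕ.*-zeroʳ (f a))

  factorials : ∀ {n} → Exponent n → ℕ
  factorials = ∏ _!

  moments : ∀ {n} → Exponent n → ℕ
  moments = ∏ Hermite.moment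

  factorials-nonZero : ∀ {n} (α : Exponent n) → ℕ.NonZero (factorials α)
  factorials-nonZero []      = _
  factorials-nonZero (a ∷ α) = ℕ.m*n≢0 (a !) (factorials α) {{a ℕ.!≢0}} {{factorials-nonZero α}}

  factorials-suc : ∀ {n} i (α : Exponent n) →
                   factorials (updateAt α i suc) ≡ suc (lookup α i) ℕ.* factorials α
  factorials-suc i α = ∏-updateAt {f = _!} {g = suc} {suc} i α λ _ → refl

  moments-suc-suc : ∀ {n} i (α : Exponent n) →
    moments (updateAt (updateAt α i suc) i suc) ≡ 2 ℕ.* suc (lookup α i) ℕ.* moments α
  moments-suc-suc i α = trans (cong moments (updateAt² i α))
    (∏-updateAt {f = Hermite.moment} {g = λ a → suc (suc a)} {λ a → 2 ℕ.* suc a} i α Hermite.moment-step)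
    where
    updateAt² : ∀ {n} i (α : Exponent n) → updateAt (updateAt α i suc) i suc ≡ updateAt α i (λ a → suc (suc a))
    updateAt² zero    (a ∷ α) = refl
    updateAt² (suc i) (a ∷ α) = cong (a ∷_) (updateAt² i α)

  -- The first moment of a centred Gaussian is 0. The other odd exponents are reached by steps of
  -- two.
  moments-odd : ∀ {n} i (α : Exponent n) → lookup α i ≡ 0 → moments (updateAt α i suc) ≡ 0
  moments-odd i α ≡0 = ∏-lookup-0 i (updateAt α i suc)
    (cong Hermite.moment (trans (lookup∘updateAt i α) (cong suc ≡0)))

-- Coefficients of products with monomials, variables and squares of variables

module ProductFormulas {c ℓ} (K : CommutativeRing c ℓ) where
  open CommutativeRing K renaming (refl to ≈-refl; sym to ≈-sym; trans to ≈-trans) hiding (zero)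
  open Polynomials K
  open Sums K
  open Exponents K
  open import Relation.Binary.Reasoning.Setoid setoid

  monomial-refl : ∀ {n} (β : Exponent n) → monomial β β ≈ 1#
  monomial-refl β with ≡-dec ℕ._≟_ β β
  ... | yes _  = ≈-refl
  ... | no  ≢β = contradiction refl ≢β

  monomial-≢ : ∀ {n} (β α : Exponent n) → α ≢ β → monomial β α ≈ 0#
  monomial-≢ β α α≢β with ≡-dec ℕ._≟_ α β
  ... | yes α≡β = contradiction α≡β α≢β
  ... | no  _   = ≈-refl

  ∑-monomial : ∀ {n d} (f : Series n) {α} → degree α ≡ d → ∑ (exponents n d) (λ β → f β * monomial β α) ≈ f α
  ∑-monomial {n} {d} f {α} ∣α∣≡d = ≈-trans
    (∑-single (exponents-unique n d) (∈-exponents⁺ ∣α∣≡d) λ β _ β≢α →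
      ≈-trans (*-congˡ (monomial-≢ β α (β≢α ∘ sym))) (zeroʳ (f β)))
    (≈-trans (*-congˡ (monomial-refl α)) (*-identityʳ (f α)))

  monomial-shift : ∀ {n} i (β γ : Exponent n) → monomial β γ ≈ monomial (updateAt β i suc) (updateAt γ i suc)
  monomial-shift i β γ with ≡-dec ℕ._≟_ γ β
  ... | yes refl = ≈-sym (monomial-refl (updateAt β i suc))
  ... | no  γ≢β  = ≈-sym (monomial-≢ (updateAt β i suc) (updateAt γ i suc) (γ≢β ∘ updateAt-suc-injective i))

  monomial-·-⊕ : ∀ {n} (β γ : Exponent n) p → (monomial β · p) (β ⊕ γ) ≈ p γ
  monomial-·-⊕ β γ p = begin
    (monomial β · p) (β ⊕ γ)
      ≈⟨ ∑-single (below-unique (β ⊕ γ)) (∈-below-⊕ β γ) (λ α _ α≢β → ≈-trans (*-congʳ (monomial-≢ β α α≢β)) (zeroˡ _)) ⟩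
    monomial β β * p (zipWith _∸_ (β ⊕ γ) β)
      ≈⟨ *-cong (monomial-refl β) (reflexive (cong p (⊕-∸ β γ))) ⟩
    1# * p γ ≈⟨ *-identityˡ (p γ) ⟩
    p γ ∎
    where
    ⊕-∸ : ∀ {n} (β γ : Exponent n) → zipWith _∸_ (β ⊕ γ) β ≡ γ
    ⊕-∸ []      []      = refl
    ⊕-∸ (b ∷ β) (c ∷ γ) = cong₂ _∷_ (ℕ.m+n∸m≡n b c) (⊕-∸ β γ)

  monomial-·-outside : ∀ {n} (β γ : Exponent n) p → (∀ δ → β ⊕ δ ≢ γ) → (monomial β · p) γ ≈ 0#
  monomial-·-outside β γ p β≰γ = ∑-zero (below γ) λ {α} α∈ → ≈-trans
    (*-congʳ (monomial-≢ β α λ { refl → β≰γ _ (⊕-∸-below γ α∈) })) (zeroˡ _)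

  var-·-suc : ∀ {n} i (γ : Exponent n) p → (var i · p) (updateAt γ i suc) ≈ p γ
  var-·-suc i γ p = ≈-trans (reflexive (cong (var i · p) (sym (ε⊕ i γ)))) (monomial-·-⊕ (updateAt 𝟎 i suc) γ p)

  var-·-zero : ∀ {n} i (γ : Exponent n) p → lookup γ i ≡ 0 → (var i · p) γ ≈ 0#
  var-·-zero i γ p ≡0 = monomial-·-outside (updateAt 𝟎 i suc) γ p λ δ eq →
    ℕ.0≢1+n (trans (sym ≡0) (trans (cong (λ α → lookup α i) (trans (sym eq) (ε⊕ i δ))) (lookup∘updateAt i δ)))

  ·-congˡ : ∀ {n} {p p′ : Series n} q → (∀ α → p α ≈ p′ α) → ∀ γ → (p · q) γ ≈ (p′ · q) γ
  ·-congˡ q p≈p′ γ = ∑-cong (below γ) λ α → *-congʳ (p≈p′ α)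

  ·-congʳ : ∀ {n} (p : Series n) {q q′} → (∀ α → q α ≈ q′ α) → ∀ γ → (p · q) γ ≈ (p · q′) γ
  ·-congʳ p q≈q′ γ = ∑-cong (below γ) λ α → *-congˡ (q≈q′ _)

  var-·-monomial : ∀ {n} i (β γ : Exponent n) → (var i · monomial β) γ ≈ monomial (updateAt β i suc) γ
  var-·-monomial i β γ with lower i γ
  ... | inj₂ (δ , refl) = ≈-trans (var-·-suc i δ (monomial β)) (monomial-shift i β δ)
  ... | inj₁ ≡0 = ≈-trans (var-·-zero i γ (monomial β) ≡0) (≈-sym (monomial-≢ (updateAt β i suc) γ λ γ≡ →
    ℕ.0≢1+n (trans (sym ≡0) (trans (cong (λ α → lookup α i) γ≡) (lookup∘updateAt i β)))))

  var²≈monomial : ∀ {n} i (γ : Exponent n) → (var i ^ 2) γ ≈ monomial (updateAt (updateAt 𝟎 i suc) i suc) γ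
  var²≈monomial i γ = ≈-trans (·-congʳ (var i) (var-·-monomial i 𝟎) γ) (var-·-monomial i (updateAt 𝟎 i suc) γ)

  var²-·-suc-suc : ∀ {n} i (γ : Exponent n) p → (var i ^ 2 · p) (updateAt (updateAt γ i suc) i suc) ≈ p γ
  var²-·-suc-suc i γ p = begin
    (var i ^ 2 · p) γ⁺⁺    ≈⟨ ·-congˡ p (var²≈monomial i) γ⁺⁺ ⟩
    (monomial 2ε · p) γ⁺⁺  ≡⟨ cong (monomial 2ε · p) (2ε⊕ γ) ⟨
    (monomial 2ε · p) (2ε ⊕ γ) ≈⟨ monomial-·-⊕ 2ε γ p ⟩
    p γ ∎
    where
    2ε = updateAt (updateAt 𝟎 i suc) i suc
    γ⁺⁺ = updateAt (updateAt γ i suc) i suc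
    2ε⊕ : ∀ γ → 2ε ⊕ γ ≡ updateAt (updateAt γ i suc) i suc
    2ε⊕ γ = trans (⊕-updateAt i (updateAt 𝟎 i suc) γ) (cong (λ α → updateAt α i suc) (ε⊕ i γ))

  var²-·-outside : ∀ {n} i (γ : Exponent n) p → (∀ δ → updateAt (updateAt δ i suc) i suc ≢ γ) →
                   (var i ^ 2 · p) γ ≈ 0#
  var²-·-outside i γ p 2≰γ = ≈-trans (·-congˡ p (var²≈monomial i) γ)
    (monomial-·-outside (updateAt (updateAt 𝟎 i suc) i suc) γ p λ δ eq → 2≰γ δ (trans
      (sym (trans (⊕-updateAt i (updateAt 𝟎 i suc) δ) (cong (λ α → updateAt α i suc) (ε⊕ i δ)))) eq))

  ∑-tabulate-suc : ∀ {r} (f : Fin (suc r) → Carrier) → ∑ (tabulate suc) f ≈ ∑ (allFin r) (f ∘ suc)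
  ∑-tabulate-suc {r} f =
    ≈-trans (reflexive (cong (λ is → ∑ is f) (sym (map-tabulate id suc)))) (∑-map suc (allFin r) f)

  ∑ᵢ≈∑ : ∀ {n r} (p : Fin r → Series n) γ → ∑ᵢ p γ ≈ ∑ (allFin r) (λ i → p i γ)
  ∑ᵢ≈∑ {r = zero}  p γ = ≈-refl
  ∑ᵢ≈∑ {r = suc r} p γ = +-congˡ (≈-trans (∑ᵢ≈∑ (p ∘ suc) γ) (≈-sym (∑-tabulate-suc λ i → p i γ)))

  ∑ᵢ-· : ∀ {n r} (p : Fin r → Series n) q γ → (∑ᵢ p · q) γ ≈ ∑ (allFin r) (λ i → (p i · q) γ)
  ∑ᵢ-· {r = r} p q γ = begin
    (∑ᵢ p · q) γ
      ≈⟨ ∑-cong (below γ) (λ α → *-congʳ (∑ᵢ≈∑ p α)) ⟩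
    ∑ (below γ) (λ α → ∑ (allFin r) (λ i → p i α) * q (zipWith _∸_ γ α))
      ≈⟨ ∑-cong (below γ) (λ α → ∑-*ʳ (allFin r) (λ i → p i α) (q (zipWith _∸_ γ α))) ⟨
    ∑ (below γ) (λ α → ∑ (allFin r) (λ i → p i α * q (zipWith _∸_ γ α)))
      ≈⟨ ∑-swap (below γ) (allFin r) _ ⟩
    ∑ (allFin r) (λ i → (p i · q) γ) ∎

-- Rational scalars in the coefficient ring

module RationalAlgebra {c ℓ} (K : CommutativeRing c ℓ)
  {ι : ℚ → CommutativeRing.Carrier K}
  (ι-isHom : IsRingHomomorphism ℚ.+-*-rawRing (CommutativeRing.rawRing K) ι) where
  open CommutativeRing K renaming (refl to ≈-refl; sym to ≈-sym; trans to ≈-trans) hiding (zero)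
  open Polynomials K using (∑)
  open Sums K
  open IsRingHomomorphism ι-isHom public
    renaming (+-homo to ι-+; *-homo to ι-*; 0#-homo to ι-0; 1#-homo to ι-1; ⟦⟧-cong to ι-cong)
  open import Relation.Binary.Reasoning.Setoid setoid
  private module ℚΣ = Sums ℚ.+-*-commutativeRing
  private module ℚP = Polynomials ℚ.+-*-commutativeRing

  ι-cast : ∀ n → ι (ℚΣ.cast n) ≈ cast n
  ι-cast zero    = ι-0
  ι-cast (suc n) = ≈-trans (ι-+ 1ℚ (ℚΣ.cast n)) (+-cong ι-1 (ι-cast n))

  ι-∑ : ∀ {a} {A : Set a} (xs : List A) f → ι (ℚP.∑ xs f) ≈ ∑ xs (ι ∘ f)
  ι-∑ []       f = ι-0
  ι-∑ (x ∷ xs) f = ≈-trans (ι-+ (f x) (ℚP.∑ xs f)) (+-congˡ (ι-∑ xs f))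

  cast-nonNeg : ∀ n → 0ℚ ℚ.≤ ℚΣ.cast n
  cast-nonNeg zero    = ℚ.≤-refl
  cast-nonNeg (suc n) = ℚ.+-mono-≤ (ℚ.<⇒≤ (ℚ.positive⁻¹ 1ℚ)) (cast-nonNeg n)

  cast-pos : ∀ n → .{{ℕ.NonZero n}} → 0ℚ ℚ.< ℚΣ.cast n
  cast-pos (suc n) = ℚ.+-mono-<-≤ (ℚ.positive⁻¹ 1ℚ) (cast-nonNeg n)

  -- Positive integers are inverted in ℚ and the inverse is mapped by `ι`, since the coefficient
  -- ring itself carries no division.
  cast⁻¹ : ∀ n → .{{ℕ.NonZero n}} → Carrier
  cast⁻¹ n = ι (ℚ.1/_ (ℚΣ.cast n) {{ℚ.pos⇒nonZero (ℚΣ.cast n) {{ℚ.positive (cast-pos n)}}}})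

  cast⁻¹-inverse : ∀ n → .{{_ : ℕ.NonZero n}} → cast⁻¹ n * cast n ≈ 1#
  cast⁻¹-inverse n = begin
    cast⁻¹ n * cast n          ≈⟨ *-congˡ (ι-cast n) ⟨
    cast⁻¹ n * ι (ℚΣ.cast n)   ≈⟨ ι-* _ (ℚΣ.cast n) ⟨
    ι (ℚ.1/ (ℚΣ.cast n) ℚ.* ℚΣ.cast n) ≈⟨ ι-cong (ℚ.*-inverseˡ (ℚΣ.cast n)) ⟩
    ι 1ℚ ≈⟨ ι-1 ⟩
    1# ∎
    where instance _ = ℚ.pos⇒nonZero (ℚΣ.cast n) {{ℚ.positive (cast-pos n)}}

  cast⁻¹-cancel : ∀ n → .{{_ : ℕ.NonZero n}} → ∀ x → cast⁻¹ n * (cast n * x) ≈ x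
  cast⁻¹-cancel n x = ≈-trans (≈-sym (*-assoc (cast⁻¹ n) (cast n) x))
    (≈-trans (*-congʳ (cast⁻¹-inverse n)) (*-identityˡ x))

  cast-cancel : ∀ n → .{{_ : ℕ.NonZero n}} → ∀ {x y} → cast n * x ≈ cast n * y → x ≈ y
  cast-cancel n {x} {y} eq = ≈-trans (≈-sym (cast⁻¹-cancel n x)) (≈-trans (*-congˡ eq) (cast⁻¹-cancel n y))

-- Derivatives as shifts, and the coefficients of the powers of q and of `f̃`

module Apolarity {c ℓ} (K : CommutativeRing c ℓ)
  {ι : ℚ → CommutativeRing.Carrier K}
  (ι-isHom : IsRingHomomorphism ℚ.+-*-rawRing (CommutativeRing.rawRing K) ι) where
  open CommutativeRing K renaming (refl to ≈-refl; sym to ≈-sym; trans to ≈-trans) hiding (zero)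
  open Polynomials K
  open Sums K
  open Exponents K
  open ProductFormulas K
  open RationalAlgebra K ι-isHom using (cast-cancel)
  open import Algebra.Properties.Semiring.Mult semiring using (×-assoc-*; ×-congʳ) renaming (_×_ to _×′_)
  open import Algebra.Properties.CommutativeSemigroup *-commutativeSemigroup using (x∙yz≈y∙xz)
  open import Relation.Binary.Reasoning.Setoid setoid

  -- apolar p γ = ∂^γ p evaluated at 0.
  apolar : ∀ {n} → Series n → Series n
  apolar p γ = cast (factorials γ) * p γ

  cast-*-assoc : ∀ m n x → cast (m ℕ.* n) * x ≈ cast m * (cast n * x)
  cast-*-assoc m n x = ≈-trans (*-congʳ (cast-* m n)) (*-assoc (cast m) (cast n) x)

  private
    ×′≈cast* : ∀ n x → n ×′ x ≈ cast n * x
    ×′≈cast* n x = ≈-sym (≈-trans (×-assoc-* n 1# x) (×-congʳ n (*-identityˡ x)))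

    apolar-updateAt : ∀ {n} i (γ : Exponent n) (p : Series n) →
      cast (suc (lookup γ i)) * (cast (factorials γ) * p (updateAt γ i suc)) ≈ apolar p (updateAt γ i suc)
    apolar-updateAt i γ p = ≈-trans
      (≈-sym (cast-*-assoc (suc (lookup γ i)) (factorials γ) (p (updateAt γ i suc))))
      (*-congʳ (cast-≡ (sym (factorials-suc i γ))))

    apolar-∂ : ∀ {n} i (p : Series n) α → apolar (∂ i p) α ≈ apolar p (updateAt α i suc)
    apolar-∂ i p α = begin
      cast (factorials α) * (suc (lookup α i) ×′ p (updateAt α i suc))
        ≈⟨ *-congˡ (×′≈cast* (suc (lookup α i)) _) ⟩
      cast (factorials α) * (cast (suc (lookup α i)) * p (updateAt α i suc))
        ≈⟨ x∙yz≈y∙xz _ _ _ ⟩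
      cast (suc (lookup α i)) * (cast (factorials α) * p (updateAt α i suc))
        ≈⟨ apolar-updateAt i α p ⟩
      apolar p (updateAt α i suc) ∎

    apolar-fold : ∀ {n} i b (p : Series n) α → apolar (fold p (∂ i) b) α ≈ apolar p (updateAt α i (b ℕ.+_))
    apolar-fold i zero    p α = reflexive (cong (apolar p) (sym (updateAt-0 i α)))
      where
      updateAt-0 : ∀ {n} i (α : Exponent n) → updateAt α i (0 ℕ.+_) ≡ α
      updateAt-0 zero    (a ∷ α) = refl
      updateAt-0 (suc i) (a ∷ α) = cong (a ∷_) (updateAt-0 i α)
    apolar-fold i (suc b) p α = ≈-trans (apolar-∂ i (fold p (∂ i) b) α) (≈-trans
      (apolar-fold i b p (updateAt α i suc)) (reflexive (cong (apolar p) (updateAt-suc i α))))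
      where
      updateAt-suc : ∀ {n} i (α : Exponent n) → updateAt (updateAt α i suc) i (b ℕ.+_) ≡ updateAt α i (suc b ℕ.+_)
      updateAt-suc zero    (a ∷ α) = cong (_∷ α) (ℕ.+-suc b a)
      updateAt-suc (suc i) (a ∷ α) = cong (a ∷_) (updateAt-suc i α)

    -- The shift of the exponent accumulated along the `foldr` that defines `∂^`, one variable at a
    -- time.
    raise : ∀ {n} → Exponent n → List (Fin n) → Exponent n → Exponent n
    raise β []       α = α
    raise β (i ∷ is) α = raise β is (updateAt α i (lookup β i ℕ.+_))

    raise-map-suc : ∀ {n} b (β : Exponent n) is a α → raise (b ∷ β) (List.map suc is) (a ∷ α) ≡ a ∷ raise β is α
    raise-map-suc b β []       a α = refl
    raise-map-suc b β (i ∷ is) a α = raise-map-suc b β is a (updateAt α i (lookup β i ℕ.+_))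

    raise-allFin : ∀ {n} (β α : Exponent n) → raise β (allFin n) α ≡ β ⊕ α
    raise-allFin []      []      = refl
    raise-allFin (b ∷ β) (a ∷ α) = trans
      (cong (λ is → raise (b ∷ β) is (b ℕ.+ a ∷ α)) (sym (map-tabulate id suc)))
      (trans (raise-map-suc b β (allFin _) (b ℕ.+ a) α) (cong (b ℕ.+ a ∷_) (raise-allFin β α)))

  -- The factorials absorb every constant produced by differentiation, so that ∂^β acts as a pure
  -- shift.
  apolar-∂^ : ∀ {n} β (p : Series n) α → apolar (∂^ β p) α ≈ apolar p (β ⊕ α)
  apolar-∂^ {n} β p α = ≈-trans (go (allFin n) α) (reflexive (cong (apolar p) (raise-allFin β α)))
    where
    go : ∀ is α → apolar (foldr (λ i q → fold q (∂ i) (lookup β i)) p is) α ≈ apolar p (raise β is α)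
    go []       α = ≈-refl
    go (i ∷ is) α = ≈-trans (apolar-fold i (lookup β i) _ α) (go is (updateAt α i (lookup β i ℕ.+_)))

  -- Up to the row factors α!, the flattening is the catalecticant matrix of p, whose entry at (β,
  -- α) depends only on β + α.
  apolar-differentiate : ∀ {n} e (D p : Series n) α →
    apolar (differentiate e D p) α ≈ ∑ (exponents n e) (λ β → D β * apolar p (β ⊕ α))
  apolar-differentiate {n} e D p α = ≈-trans (≈-sym (∑-* (exponents n e) (cast (factorials α)) _))
    (∑-cong (exponents n e) λ β → ≈-trans (x∙yz≈y∙xz _ (D β) _) (*-congˡ (apolar-∂^ β p α)))

  quadric : ∀ n → Series n
  quadric n = ∑ᵢ λ i → var i ^ 2

  private
    -- γᵢ (γᵢ - 1) moments (γ - 2εᵢ) = ½ γᵢ moments γ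
    quadric-term : ∀ {n} i k (γ : Exponent n) (p : Series n) →
      (∀ δ → updateAt (updateAt δ i suc) i suc ≡ γ → apolar p δ ≈ cast (k ! ℕ.* moments δ)) →
      cast 2 * (cast (factorials γ) * (var i ^ 2 · p) γ) ≈ cast (lookup γ i ℕ.* (k ! ℕ.* moments γ))
    quadric-term i k γ p hyp with lower i γ
    ... | inj₁ ≡0 = ≈-trans
      (*-congˡ (≈-trans (*-congˡ (var²-·-outside i γ p λ { δ refl →
        ℕ.0≢1+n (trans (sym ≡0) (lookup∘updateAt i (updateAt δ i suc))) })) (zeroʳ _)))
      (≈-trans (zeroʳ (cast 2)) (cast-≡ (cong (ℕ._* (k ! ℕ.* moments γ)) (sym ≡0))))
    ... | inj₂ (δ , refl) with lower i δ
    -- Here γᵢ = 1: xᵢ² does not divide x^γ, and on the other side a first moment vanishes.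
    ...   | inj₁ ≡0 = ≈-trans
      (*-congˡ (≈-trans (*-congˡ (var²-·-outside i γ p λ ζ eq →
        ℕ.0≢1+n (trans (sym ≡0) (trans (cong (λ α → lookup α i) (sym (updateAt-suc-injective i eq))) (lookup∘updateAt i ζ)))))
        (zeroʳ _)))
      (≈-trans (zeroʳ (cast 2)) (cast-≡ (sym (trans
        (cong (λ z → lookup γ i ℕ.* (k ! ℕ.* z)) (moments-odd i δ ≡0))
        (trans (cong (lookup γ i ℕ.*_) (ℕ.*-zeroʳ (k !))) (ℕ.*-zeroʳ (lookup γ i)))))))
    ...   | inj₂ (ζ , refl) = begin
      cast 2 * (cast (factorials γ) * (var i ^ 2 · p) γ)
        ≈⟨ *-congˡ (*-cong (cast-≡ γ!≡) (var²-·-suc-suc i ζ p)) ⟩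
      cast 2 * (cast ((2 ℕ.+ z) ℕ.* suc z ℕ.* factorials ζ) * p ζ)
        ≈⟨ *-congˡ (cast-*-assoc ((2 ℕ.+ z) ℕ.* suc z) (factorials ζ) (p ζ)) ⟩
      cast 2 * (cast ((2 ℕ.+ z) ℕ.* suc z) * apolar p ζ)
        ≈⟨ *-congˡ (*-congˡ (hyp ζ refl)) ⟩
      cast 2 * (cast ((2 ℕ.+ z) ℕ.* suc z) * cast (k ! ℕ.* moments ζ))
        ≈⟨ *-congˡ (cast-* ((2 ℕ.+ z) ℕ.* suc z) (k ! ℕ.* moments ζ)) ⟨
      cast 2 * cast ((2 ℕ.+ z) ℕ.* suc z ℕ.* (k ! ℕ.* moments ζ))
        ≈⟨ cast-* 2 ((2 ℕ.+ z) ℕ.* suc z ℕ.* (k ! ℕ.* moments ζ)) ⟨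
      cast (2 ℕ.* ((2 ℕ.+ z) ℕ.* suc z ℕ.* (k ! ℕ.* moments ζ)))
        ≈⟨ cast-≡ (trans
             (solve 3 (λ z k m → con 2 :* ((con 2 :+ z) :* (con 1 :+ z) :* (k :* m)) :=
                                 (con 2 :+ z) :* (k :* (con 2 :* (con 1 :+ z) :* m))) refl z (k !) (moments ζ))
             (sym (cong₂ (λ a m → a ℕ.* (k ! ℕ.* m)) γᵢ≡ (moments-suc-suc i ζ)))) ⟩
      cast (lookup γ i ℕ.* (k ! ℕ.* moments γ)) ∎
      where
      open +-*-Solver using (solve; _:+_; _:*_; _:=_; con)
      z = lookup ζ i
      δᵢ≡ : lookup (updateAt ζ i suc) i ≡ suc z
      δᵢ≡ = lookup∘updateAt i ζ
      γᵢ≡ : lookup γ i ≡ 2 ℕ.+ z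
      γᵢ≡ = trans (lookup∘updateAt i (updateAt ζ i suc)) (cong suc δᵢ≡)
      γ!≡ : factorials γ ≡ (2 ℕ.+ z) ℕ.* suc z ℕ.* factorials ζ
      γ!≡ = trans (factorials-suc i (updateAt ζ i suc)) (trans
        (cong₂ ℕ._*_ (cong suc δᵢ≡) (factorials-suc i ζ)) (sym (ℕ.*-assoc (2 ℕ.+ z) (suc z) (factorials ζ))))

  apolar-∑ᵢ-· : ∀ {n r} (p : Fin r → Series n) q m γ →
    cast m * apolar (∑ᵢ p · q) γ ≈ ∑ (allFin r) (λ i → cast m * (cast (factorials γ) * (p i · q) γ))
  apolar-∑ᵢ-· {r = r} p q m γ = begin
    cast m * (cast (factorials γ) * (∑ᵢ p · q) γ)
      ≈⟨ *-congˡ (*-congˡ (∑ᵢ-· p q γ)) ⟩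
    cast m * (cast (factorials γ) * ∑ (allFin r) (λ i → (p i · q) γ))
      ≈⟨ *-congˡ (∑-* (allFin r) (cast (factorials γ)) _) ⟨
    cast m * ∑ (allFin r) (λ i → cast (factorials γ) * (p i · q) γ)
      ≈⟨ ∑-* (allFin r) (cast m) _ ⟨
    ∑ (allFin r) (λ i → cast m * (cast (factorials γ) * (p i · q) γ)) ∎

  -- Induction on k. After doubling, the summand xᵢ² of q contributes γᵢ k! G(γ), and ∑ γᵢ = 2 (k +
  -- 1) turns k! into (k + 1)!. The doubling keeps the identity in natural numbers and is cancelled
  -- at the end.
  apolar-quadric^ : ∀ {n} k (γ : Exponent n) → degree γ ≡ 2 ℕ.* k →
                    apolar (quadric n ^ k) γ ≈ cast (k ! ℕ.* moments γ)
  apolar-quadric^ {n} zero γ ≡0 with degree-0 γ ≡0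
  ... | refl = ≈-trans (*-cong (cast-≡ (∏-𝟎 n refl)) (monomial-refl (𝟎 {n}))) (≈-trans (*-identityʳ _)
    (cast-≡ (sym (trans (ℕ.*-identityˡ (moments (𝟎 {n}))) (∏-𝟎 n refl)))))
  apolar-quadric^ {n} (suc k) γ ≡2+2k = cast-cancel 2 (begin
    cast 2 * apolar (quadric n · quadric n ^ k) γ
      ≈⟨ apolar-∑ᵢ-· (λ i → var i ^ 2) (quadric n ^ k) 2 γ ⟩
    ∑ (allFin n) (λ i → cast 2 * (cast (factorials γ) * (var i ^ 2 · quadric n ^ k) γ))
      ≈⟨ ∑-cong (allFin n) (λ i → quadric-term i k γ (quadric n ^ k) λ δ eq →
           apolar-quadric^ k δ (ℕ.suc-injective (ℕ.suc-injective (trans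
             (sym (trans (degree-suc (updateAt δ i suc) i) (cong suc (degree-suc δ i))))
             (trans (cong degree eq) (trans ≡2+2k (ℕ.*-suc 2 k))))))) ⟩
    ∑ (allFin n) (λ i → cast (lookup γ i ℕ.* (k ! ℕ.* moments γ)))
      ≈⟨ ∑-cong (allFin n) (λ i → cast-* (lookup γ i) _) ⟩
    ∑ (allFin n) (λ i → cast (lookup γ i) * cast (k ! ℕ.* moments γ))
      ≈⟨ ∑-*ʳ (allFin n) (cast ∘ lookup γ) _ ⟩
    ∑ (allFin n) (cast ∘ lookup γ) * cast (k ! ℕ.* moments γ)
      ≈⟨ *-congʳ (≈-trans (∑-cast (allFin n) (lookup γ)) (cast-≡ (trans (sum-lookup γ) ≡2+2k))) ⟩
    cast (2 ℕ.* suc k) * cast (k ! ℕ.* moments γ)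
      ≈⟨ cast-* (2 ℕ.* suc k) (k ! ℕ.* moments γ) ⟨
    cast (2 ℕ.* suc k ℕ.* (k ! ℕ.* moments γ))
      ≈⟨ cast-≡ (solve 3 (λ k f m → con 2 :* (con 1 :+ k) :* (f :* m) := con 2 :* ((con 1 :+ k) :* f :* m))
           refl k (k !) (moments γ)) ⟩
    cast (2 ℕ.* (suc k ! ℕ.* moments γ))
      ≈⟨ cast-* 2 (suc k ! ℕ.* moments γ) ⟩
    cast 2 * cast (suc k ! ℕ.* moments γ) ∎)
    where open +-*-Solver using (solve; _:+_; _:*_; _:=_; con)

  apolar-f̃ : ∀ {n} k (γ : Exponent n) → degree γ ≡ 2 ℕ.* k ℕ.+ 1 →
    cast 2 * apolar (f̃-series n k) γ ≈ cast (k !) * ∑ (allFin n) (λ i → cast (moments (updateAt γ i suc)))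
  apolar-f̃ {n} k γ ≡2k+1 = begin
    cast 2 * apolar (∑ᵢ var · quadric n ^ k) γ
      ≈⟨ apolar-∑ᵢ-· var (quadric n ^ k) 2 γ ⟩
    ∑ (allFin n) (λ i → cast 2 * (cast (factorials γ) * (var i · quadric n ^ k) γ))
      ≈⟨ ∑-cong (allFin n) term ⟩
    ∑ (allFin n) (λ i → cast (k !) * cast (moments (updateAt γ i suc)))
      ≈⟨ ∑-* (allFin n) (cast (k !)) _ ⟩
    cast (k !) * ∑ (allFin n) (λ i → cast (moments (updateAt γ i suc))) ∎
    where
    open +-*-Solver using (solve; _:+_; _:*_; _:=_; con)
    -- γᵢ moments (γ - εᵢ) = ½ moments (γ + εᵢ)
    term : ∀ i → cast 2 * (cast (factorials γ) * (var i · quadric n ^ k) γ) ≈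
                 cast (k !) * cast (moments (updateAt γ i suc))
    term i with lower i γ
    ... | inj₁ ≡0 = ≈-trans
      (*-congˡ (≈-trans (*-congˡ (var-·-zero i γ (quadric n ^ k) ≡0)) (zeroʳ _)))
      (≈-trans (zeroʳ (cast 2)) (≈-sym (≈-trans (*-congˡ (cast-≡ (moments-odd i γ ≡0))) (zeroʳ (cast (k !))))))
    ... | inj₂ (δ , refl) = begin
      cast 2 * (cast (factorials γ) * (var i · quadric n ^ k) γ)
        ≈⟨ *-congˡ (*-cong (cast-≡ (factorials-suc i δ)) (var-·-suc i δ (quadric n ^ k))) ⟩
      cast 2 * (cast (suc d ℕ.* factorials δ) * (quadric n ^ k) δ)
        ≈⟨ *-congˡ (cast-*-assoc (suc d) (factorials δ) _) ⟩
      cast 2 * (cast (suc d) * apolar (quadric n ^ k) δ)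
        ≈⟨ *-congˡ (*-congˡ (apolar-quadric^ k δ (ℕ.suc-injective
             (trans (sym (degree-suc δ i)) (trans ≡2k+1 (ℕ.+-comm (2 ℕ.* k) 1)))))) ⟩
      cast 2 * (cast (suc d) * cast (k ! ℕ.* moments δ))
        ≈⟨ *-congˡ (cast-* (suc d) (k ! ℕ.* moments δ)) ⟨
      cast 2 * cast (suc d ℕ.* (k ! ℕ.* moments δ))
        ≈⟨ cast-* 2 (suc d ℕ.* (k ! ℕ.* moments δ)) ⟨
      cast (2 ℕ.* (suc d ℕ.* (k ! ℕ.* moments δ)))
        ≈⟨ cast-≡ (trans
             (solve 3 (λ d k m → con 2 :* ((con 1 :+ d) :* (k :* m)) := k :* (con 2 :* (con 1 :+ d) :* m))
               refl d (k !) (moments δ))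
             (cong (k ! ℕ.*_) (sym (moments-suc-suc i δ)))) ⟩
      cast (k ! ℕ.* moments (updateAt γ i suc))
        ≈⟨ cast-* (k !) _ ⟩
      cast (k !) * cast (moments (updateAt γ i suc)) ∎
      where d = lookup δ i

-- Positive definite rational systems, solved by rank-one updates

module PositiveDefinite where
  open import Data.Rational.Base using (_+_; _*_; _-_; -_)
  open Polynomials ℚ.+-*-commutativeRing using (∑; ∑-cong; ∑-*; ∑-+)
  open ℚ-Solver.+-*-Solver using (solve; _:+_; _:*_; _:-_; :-_; _:=_; con)
  open ≡-Reasoning

  *-nonNeg : ∀ {p q} → 0ℚ ℚ.≤ p → 0ℚ ℚ.≤ q → 0ℚ ℚ.≤ p * q
  *-nonNeg {p} {q} 0≤p 0≤q = ℚ.nonNegative⁻¹ (p * q)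
    {{ℚ.nonNeg*nonNeg⇒nonNeg p {{ℚ.nonNegative 0≤p}} q {{ℚ.nonNegative 0≤q}}}}

  square-nonNeg : ∀ p → 0ℚ ℚ.≤ p * p
  square-nonNeg p with ℚ.∣p∣≡p∨∣p∣≡-p p
  ... | inj₁ ∣p∣≡p  = subst (λ q → 0ℚ ℚ.≤ q * q) ∣p∣≡p (*-nonNeg (ℚ.0≤∣p∣ p) (ℚ.0≤∣p∣ p))
  ... | inj₂ ∣p∣≡-p = subst (0ℚ ℚ.≤_)
    (trans (cong (λ q → q * q) ∣p∣≡-p) (solve 1 (λ p → (:- p) :* (:- p) := p :* p) refl p))
    (*-nonNeg (ℚ.0≤∣p∣ p) (ℚ.0≤∣p∣ p))

  ∑-nonNeg : ∀ {a} {A : Set a} (xs : List A) {f} → (∀ x → 0ℚ ℚ.≤ f x) → 0ℚ ℚ.≤ ∑ xs f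
  ∑-nonNeg []       0≤f = ℚ.≤-refl
  ∑-nonNeg (x ∷ xs) 0≤f = ℚ.+-mono-≤ (0≤f x) (∑-nonNeg xs 0≤f)

  module _ {a b} {X : Set a} {Y : Set b} (xs : List X)
    (d : X → ℚ) (0<d : ∀ x → 0ℚ ℚ.< d x)
    (c : Y → ℚ) (0≤c : ∀ y → 0ℚ ℚ.≤ c y)
    (v : Y → X → ℚ) where

    infix 8 ⟨_,_⟩
    ⟨_,_⟩ : (X → ℚ) → (X → ℚ) → ℚ
    ⟨ z , w ⟩ = ∑ xs (λ x → z x * w x)

    -- The matrix diag(d) + ∑ c_y v_y v_yᵀ over the y in a list.
    form : List Y → (X → ℚ) → X → ℚ
    form []       z x = d x * z x
    form (y ∷ ys) z x = form ys z x + c y * ⟨ v y , z ⟩ * v y x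

    ⟨⟩-linear : ∀ u z w t → ⟨ u , (λ x → z x - t * w x) ⟩ ≡ ⟨ u , z ⟩ - t * ⟨ u , w ⟩
    ⟨⟩-linear u z w t = begin
      ∑ xs (λ x → u x * (z x - t * w x))
        ≡⟨ ∑-cong xs (λ x → solve 4 (λ u z w t → u :* (z :- t :* w) := u :* z :+ (con 0ℚ :- t) :* (u :* w)) refl (u x) (z x) (w x) t) ⟩
      ∑ xs (λ x → u x * z x + (0ℚ - t) * (u x * w x))
        ≡⟨ ∑-+ xs (λ x → u x * z x) (λ x → (0ℚ - t) * (u x * w x)) ⟩
      ⟨ u , z ⟩ + ∑ xs (λ x → (0ℚ - t) * (u x * w x))
        ≡⟨ cong (⟨ u , z ⟩ +_) (∑-* xs (0ℚ - t) (λ x → u x * w x)) ⟩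
      ⟨ u , z ⟩ + (0ℚ - t) * ⟨ u , w ⟩
        ≡⟨ solve 3 (λ p t q → p :+ (con 0ℚ :- t) :* q := p :- t :* q) refl ⟨ u , z ⟩ t ⟨ u , w ⟩ ⟩
      ⟨ u , z ⟩ - t * ⟨ u , w ⟩ ∎

    form-linear : ∀ ys z w t x → form ys (λ x → z x - t * w x) x ≡ form ys z x - t * form ys w x
    form-linear []       z w t x =
      solve 4 (λ d z t w → d :* (z :- t :* w) := d :* z :- t :* (d :* w)) refl (d x) (z x) t (w x)
    form-linear (y ∷ ys) z w t x = trans
      (cong₂ (λ f g → f + c y * g * v y x) (form-linear ys z w t x) (⟨⟩-linear (v y) z w t))
      (solve 7 (λ f g t c p q v → (f :- t :* g) :+ c :* (p :- t :* q) :* v :=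
                                  (f :+ c :* p :* v) :- t :* (g :+ c :* q :* v))
        refl (form ys z x) (form ys w x) t (c y) ⟨ v y , z ⟩ ⟨ v y , w ⟩ (v y x))

    -- Each rank-one term adds c ⟨v,z⟩². This is what keeps the denominator of the next rank-one
    -- update positive.
    form-nonNeg : ∀ ys z → 0ℚ ℚ.≤ ⟨ z , form ys z ⟩
    form-nonNeg []       z = ∑-nonNeg xs λ x → subst (0ℚ ℚ.≤_)
      (solve 2 (λ d z → d :* (z :* z) := z :* (d :* z)) refl (d x) (z x))
      (*-nonNeg (ℚ.<⇒≤ (0<d x)) (square-nonNeg (z x)))
    form-nonNeg (y ∷ ys) z = subst (0ℚ ℚ.≤_) (sym split)
      (ℚ.+-mono-≤ (form-nonNeg ys z) (*-nonNeg (0≤c y) (square-nonNeg ⟨ v y , z ⟩)))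
      where
      p = ⟨ v y , z ⟩
      split : ⟨ z , form (y ∷ ys) z ⟩ ≡ ⟨ z , form ys z ⟩ + c y * (p * p)
      split = begin
        ∑ xs (λ x → z x * (form ys z x + c y * p * v y x))
          ≡⟨ ∑-cong xs (λ x → solve 5 (λ z f c p v → z :* (f :+ c :* p :* v) := z :* f :+ c :* p :* (v :* z)) refl
               (z x) (form ys z x) (c y) p (v y x)) ⟩
        ∑ xs (λ x → z x * form ys z x + c y * p * (v y x * z x))
          ≡⟨ ∑-+ xs (λ x → z x * form ys z x) (λ x → c y * p * (v y x * z x)) ⟩
        ⟨ z , form ys z ⟩ + ∑ xs (λ x → c y * p * (v y x * z x))
          ≡⟨ cong (⟨ z , form ys z ⟩ +_) (trans (∑-* xs (c y * p) (λ x → v y x * z x)) (ℚ.*-assoc (c y) p p)) ⟩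
        ⟨ z , form ys z ⟩ + c y * (p * p) ∎

    -- Adding c v vᵀ to a solvable system: if u and z solve the old one for w and v, then
    -- u - t z solves the new one for w, where t (1 + c ⟨v,z⟩) = c ⟨v,u⟩.
    form-surjective : ∀ ys w → ∃[ z ] ∀ x → form ys z x ≡ w x
    form-surjective []       w = (λ x → (ℚ.1/ d x) {{nz x}} * w x) , λ x →
      let instance _ = nz x in
      trans (sym (ℚ.*-assoc (d x) (ℚ.1/ d x) (w x)))
        (trans (cong (_* w x) (ℚ.*-inverseʳ (d x))) (ℚ.*-identityˡ (w x)))
      where
      nz : ∀ x → ℚ.NonZero (d x)
      nz x = ℚ.pos⇒nonZero (d x) {{ℚ.positive (0<d x)}}
    form-surjective (y ∷ ys) w with form-surjective ys w | form-surjective ys (v y)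
    ... | u , u-sol | z , z-sol = (λ x → u x - t * z x) , λ x → begin
      form ys (λ x → u x - t * z x) x + c y * ⟨ v y , (λ x → u x - t * z x) ⟩ * v y x
        ≡⟨ cong₂ (λ f g → f + c y * g * v y x)
             (trans (form-linear ys u z t x) (cong₂ (λ f g → f - t * g) (u-sol x) (z-sol x)))
             (⟨⟩-linear (v y) u z t) ⟩
      (w x - t * v y x) + c y * (p - t * q) * v y x
        ≡⟨ solve 6 (λ w t v c p q → (w :- t :* v) :+ c :* (p :- t :* q) :* v :=
                                    w :+ (c :* p :- t :* (con 1ℚ :+ c :* q)) :* v) refl (w x) t (v y x) (c y) p q ⟩
      w x + (c y * p - t * s) * v y x
        ≡⟨ cong (λ r → w x + (c y * p - r) * v y x) t*s ⟩
      w x + (c y * p - c y * p) * v y x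
        ≡⟨ solve 3 (λ w k v → w :+ (k :- k) :* v := w) refl (w x) (c y * p) (v y x) ⟩
      w x ∎
      where
      p = ⟨ v y , u ⟩
      q = ⟨ v y , z ⟩
      s = 1ℚ + c y * q
      -- As z solves the old system for v, q = ⟨v,z⟩ is the value of the old quadratic form at z;
      -- hence s = 1 + c q is at least 1.
      0≤q : 0ℚ ℚ.≤ q
      0≤q = subst (0ℚ ℚ.≤_)
        (∑-cong xs λ x → trans (cong (z x *_) (z-sol x)) (ℚ.*-comm (z x) (v y x))) (form-nonNeg ys z)
      instance
        s≢0 : ℚ.NonZero s
        s≢0 = ℚ.pos⇒nonZero s {{ℚ.positive (ℚ.+-mono-<-≤ (ℚ.positive⁻¹ 1ℚ) (*-nonNeg (0≤c y) 0≤q))}}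
      t = c y * p * ℚ.1/ s
      t*s : t * s ≡ c y * p
      t*s = trans (ℚ.*-assoc (c y * p) (ℚ.1/ s) s)
        (trans (cong (c y * p *_) (ℚ.*-inverseˡ s)) (ℚ.*-identityʳ (c y * p)))

-- The moment matrix in a fixed degree and its inverse

module Hankel {c ℓ} (K : CommutativeRing c ℓ)
  {ι : ℚ → CommutativeRing.Carrier K}
  (ι-isHom : IsRingHomomorphism ℚ.+-*-rawRing (CommutativeRing.rawRing K) ι) where
  open CommutativeRing K renaming (refl to ≈-refl; sym to ≈-sym; trans to ≈-trans) hiding (zero)
  open Polynomials K
  open Sums K
  open Exponents K
  open ProductFormulas K
  open RationalAlgebra K ι-isHom using (ι-+; ι-*; ι-0; ι-1; ι-cong; ι-cast; ι-∑; cast-pos; cast-nonNeg)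
  open import Algebra.Properties.CommutativeSemigroup +-commutativeSemigroup using (xy∙z≈x∙zy)
  open import Relation.Binary.Reasoning.Setoid setoid
  private
    module ℚΣ = Sums ℚ.+-*-commutativeRing
    module ℚP = Polynomials ℚ.+-*-commutativeRing

  coefficients : ∀ {n} → Exponent n → Exponent n → ℕ
  coefficients []      []      = 1
  coefficients (a ∷ α) (b ∷ β) = Hermite.coefficient a b ℕ.* coefficients α β

  norms : ∀ {n} → Exponent n → ℕ
  norms = ∏ Hermite.norm

  norms-nonZero : ∀ {n} (α : Exponent n) → ℕ.NonZero (norms α)
  norms-nonZero []      = _
  norms-nonZero (a ∷ α) = ℕ.m*n≢0 (Hermite.norm a) (norms α) {{norm-nonZero a}} {{norms-nonZero α}}
    where
    norm-nonZero : ∀ a → ℕ.NonZero (Hermite.norm a)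
    norm-nonZero zero    = _
    norm-nonZero (suc a) = ℕ.m*n≢0 (2 ℕ.* suc a) (Hermite.norm a) {{_}} {{norm-nonZero a}}

  coefficients-diagonal : ∀ {n} (α : Exponent n) → coefficients α α ≡ 1
  coefficients-diagonal []      = refl
  coefficients-diagonal (a ∷ α) = cong₂ ℕ._*_ (Hermite.coefficient-diagonal a) (coefficients-diagonal α)

  -- The expansion of x^α involves H_β only for β ≤ α in every variable, and then equal degrees
  -- force β = α.
  coefficients-≢ : ∀ {n} {α β : Exponent n} → degree α ≡ degree β → β ≢ α → coefficients α β ≡ 0
  coefficients-≢ {α = α} {β} ∣α∣≡∣β∣ β≢α with dominated α β
    where
    dominated : ∀ {n} (α β : Exponent n) → coefficients α β ≡ 0 ⊎ ∃[ δ ] δ ⊕ β ≡ α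
    dominated []      []      = inj₂ ([] , refl)
    dominated (a ∷ α) (b ∷ β) with b ℕ.≤? a | dominated α β
    ... | no b≰a | _ = inj₁ (cong (ℕ._* coefficients α β) (Hermite.coefficient-above (ℕ.≰⇒> b≰a)))
    ... | _ | inj₁ ≡0 = inj₁ (trans (cong (Hermite.coefficient a b ℕ.*_) ≡0) (ℕ.*-zeroʳ (Hermite.coefficient a b)))
    ... | yes b≤a | inj₂ (δ , δ⊕β) = inj₂ (a ∸ b ∷ δ , cong₂ _∷_ (ℕ.m∸n+n≡m b≤a) δ⊕β)
  ... | inj₁ ≡0 = ≡0
  ... | inj₂ (δ , refl) = contradiction (sym (trans (cong (_⊕ β) δ≡𝟎) (𝟎⊕ β))) β≢α
    where
    δ≡𝟎 : δ ≡ 𝟎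
    δ≡𝟎 = degree-0 δ (ℕ.+-cancelʳ-≡ (degree β) (degree δ) 0 (trans (sym (degree-⊕ δ β)) ∣α∣≡∣β∣))

  gramTerms : ∀ {n} → Exponent n → Exponent n → Exponent n → ℕ
  gramTerms α β γ = norms γ ℕ.* (coefficients α γ ℕ.* coefficients β γ)

  -- The sum runs over a box of exponents because there it factors into the one-variable identities;
  -- |α| ≤ m makes every side of the box long enough for `Hermite.gram≡moment`.
  ∑-gramTerms : ∀ {n m} (α β : Exponent n) → degree α ≤ m →
                ∑ (below (replicate n m)) (λ γ → cast (gramTerms α β γ)) ≈ cast (moments (α ⊕ β))
  ∑-gramTerms []      []      _ = +-identityʳ (cast 1)
  ∑-gramTerms {suc n} {m} (a ∷ α) (b ∷ β) ≤m = begin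
    ∑ (below (replicate (suc n) m)) (λ γ → cast (gramTerms (a ∷ α) (b ∷ β) γ))
      ≈⟨ ∑-cartesianProductWith _∷_ (upTo (suc m)) γs _ ⟩
    ∑ (upTo (suc m)) (λ i → ∑ γs (λ γ → cast (gramTerms (a ∷ α) (b ∷ β) (i ∷ γ))))
      ≈⟨ ∑-cong (upTo (suc m)) (λ i → ∑-cong γs (λ γ → ≈-trans (cast-≡ (split i γ)) (cast-* (g i) (gramTerms α β γ)))) ⟩
    ∑ (upTo (suc m)) (λ i → ∑ γs (λ γ → cast (g i) * cast (gramTerms α β γ)))
      ≈⟨ ∑-cong (upTo (suc m)) (λ i → ∑-* γs (cast (g i)) _) ⟩
    ∑ (upTo (suc m)) (λ i → cast (g i) * ∑ γs (λ γ → cast (gramTerms α β γ)))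
      ≈⟨ ∑-*ʳ (upTo (suc m)) (cast ∘ g) _ ⟩
    ∑ (upTo (suc m)) (cast ∘ g) * ∑ γs (λ γ → cast (gramTerms α β γ))
      ≈⟨ *-cong
           (≈-trans (∑-gram (suc m)) (cast-≡ (Hermite.gram≡moment a b (ℕ.≤-trans (ℕ.m≤m+n a (degree α)) ≤m))))
           (∑-gramTerms α β (ℕ.≤-trans (ℕ.m≤n+m (degree α) a) ≤m)) ⟩
    cast (Hermite.moment (a ℕ.+ b)) * cast (moments (α ⊕ β))
      ≈⟨ cast-* (Hermite.moment (a ℕ.+ b)) (moments (α ⊕ β)) ⟨
    cast (moments ((a ∷ α) ⊕ (b ∷ β))) ∎
    where
    open +-*-Solver using (solve; _:*_; _:=_)
    γs = below (replicate n m)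
    g = Hermite.gramTerm a b
    split : ∀ i γ → gramTerms (a ∷ α) (b ∷ β) (i ∷ γ) ≡ g i ℕ.* gramTerms α β γ
    split i γ = solve 6 (λ n n′ x x′ y y′ → (n :* n′) :* ((x :* x′) :* (y :* y′)) := (n :* (x :* y)) :* (n′ :* (x′ :* y′)))
      refl (Hermite.norm i) (norms γ) (Hermite.coefficient a i) (coefficients α γ) (Hermite.coefficient b i) (coefficients β γ)
    ∑-gram : ∀ N → ∑ (upTo N) (cast ∘ g) ≈ cast (Hermite.gram N a b)
    ∑-gram zero    = ≈-refl
    ∑-gram (suc N) = begin
      ∑ (upTo (suc N)) (cast ∘ g)          ≡⟨ cong (λ is → ∑ is (cast ∘ g)) (upTo-∷ʳ N) ⟨
      ∑ (upTo N ++ N ∷ []) (cast ∘ g)      ≈⟨ ∑-++ (upTo N) (N ∷ []) (cast ∘ g) ⟩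
      ∑ (upTo N) (cast ∘ g) + (cast (g N) + 0#) ≈⟨ +-cong (∑-gram N) (+-identityʳ (cast (g N))) ⟩
      cast (Hermite.gram N a b) + cast (g N) ≈⟨ cast-+ (Hermite.gram N a b) (g N) ⟨
      cast (Hermite.gram (suc N) a b) ∎

  module _ (n m : ℕ) where
    private
      E rest : List (Exponent n)
      E    = exponents n m
      rest = filter (λ γ → ¬? (degree γ ℕ.≟ m)) (below (replicate n m))

      -- The norms occur twice: for γ of degree m the vector of coefficients at γ is a unit vector
      -- on `E`, so these components make up the diagonal, while the components in `rest` enter as
      -- rank-one terms.
      form : List (Exponent n) → (Exponent n → ℚ) → Exponent n → ℚ
      form = PositiveDefinite.form E
        (ℚΣ.cast ∘ norms) (λ γ → cast-pos (norms γ) {{norms-nonZero γ}})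
        (ℚΣ.cast ∘ norms) (cast-nonNeg ∘ norms)
        (λ γ α → ℚΣ.cast (coefficients α γ))

      -- The contribution of the Hermite component γ to the entry at α of the moment matrix applied
      -- to z.
      term : (Exponent n → ℚ) → Exponent n → Exponent n → Carrier
      term z α γ = ∑ E (λ β → ι (z β) * cast (gramTerms β α γ))

      ι-rank-one : ∀ z α γ →
        ι (ℚΣ.cast (norms γ) ℚ.* ℚP.∑ E (λ β → ℚΣ.cast (coefficients β γ) ℚ.* z β) ℚ.* ℚΣ.cast (coefficients α γ))
        ≈ term z α γ
      ι-rank-one z α γ = begin
        ι (ℚΣ.cast N ℚ.* s ℚ.* ℚΣ.cast C)
          ≈⟨ ≈-trans (ι-* (ℚΣ.cast N ℚ.* s) (ℚΣ.cast C)) (*-cong (ι-* (ℚΣ.cast N) s) (ι-cast C)) ⟩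
        ι (ℚΣ.cast N) * ι s * cast C
          ≈⟨ *-congʳ (*-cong (ι-cast N) (ι-∑ E _)) ⟩
        cast N * ∑ E (λ β → ι (ℚΣ.cast (coefficients β γ) ℚ.* z β)) * cast C
          ≈⟨ *-congʳ (∑-* E (cast N) _) ⟨
        ∑ E (λ β → cast N * ι (ℚΣ.cast (coefficients β γ) ℚ.* z β)) * cast C
          ≈⟨ ∑-*ʳ E _ (cast C) ⟨
        ∑ E (λ β → cast N * ι (ℚΣ.cast (coefficients β γ) ℚ.* z β) * cast C)
          ≈⟨ ∑-cong E rearrange ⟩
        term z α γ ∎
        where
        N = norms γ
        C = coefficients α γ
        s = ℚP.∑ E (λ β → ℚΣ.cast (coefficients β γ) ℚ.* z β)
        rearrange : ∀ β → cast N * ι (ℚΣ.cast (coefficients β γ) ℚ.* z β) * cast C ≈ ι (z β) * cast (gramTerms β α γ)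
        rearrange β = begin
          cast N * ι (ℚΣ.cast B ℚ.* z β) * cast C
            ≈⟨ *-congʳ (*-congˡ (≈-trans (ι-* (ℚΣ.cast B) (z β)) (*-congʳ (ι-cast B)))) ⟩
          cast N * (cast B * ι (z β)) * cast C
            ≈⟨ *-congʳ (≈-trans (≈-sym (*-assoc (cast N) (cast B) (ι (z β)))) (*-comm _ (ι (z β)))) ⟩
          ι (z β) * (cast N * cast B) * cast C
            ≈⟨ *-assoc (ι (z β)) (cast N * cast B) (cast C) ⟩
          ι (z β) * (cast N * cast B * cast C)
            ≈⟨ *-congˡ (≈-trans (*-assoc (cast N) (cast B) (cast C)) (*-congˡ (≈-sym (cast-* B C)))) ⟩
          ι (z β) * (cast N * cast (B ℕ.* C))
            ≈⟨ *-congˡ (cast-* N (B ℕ.* C)) ⟨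
          ι (z β) * cast (gramTerms β α γ) ∎
          where B = coefficients β γ

      ι-form : ∀ z α γs → ι (form γs z α) ≈ ι (z α) * cast (norms α) + ∑ γs (term z α)
      ι-form z α [] = ≈-trans (ι-* (ℚΣ.cast (norms α)) (z α)) (≈-trans (*-congʳ (ι-cast (norms α)))
        (≈-trans (*-comm (cast (norms α)) (ι (z α))) (≈-sym (+-identityʳ _))))
      ι-form z α (γ ∷ γs) = ≈-trans (ι-+ _ _) (≈-trans
        (+-cong (ι-form z α γs) (ι-rank-one z α γ)) (xy∙z≈x∙zy _ (∑ γs (term z α)) (term z α γ)))

      -- Of the Hermite components of top degree m only the diagonal one survives.
      ∑-top-term : ∀ z {α} → α ∈ E → ∑ E (term z α) ≈ ι (z α) * cast (norms α)
      ∑-top-term z {α} α∈ = begin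
        ∑ E (term z α)
          ≈⟨ ∑-single (exponents-unique n m) α∈ (λ γ γ∈ γ≢α → ∑-zero E λ {β} _ → vanish (z β) (trans
               (cong (λ c → norms γ ℕ.* (coefficients β γ ℕ.* c)) (coefficients-≢ {α = α} {γ} (same-degree α∈ γ∈) γ≢α))
               (trans (cong (norms γ ℕ.*_) (ℕ.*-zeroʳ (coefficients β γ))) (ℕ.*-zeroʳ (norms γ))))) ⟩
        term z α α
          ≈⟨ ∑-single (exponents-unique n m) α∈ (λ β β∈ β≢α → vanish (z β) (trans
               (cong (λ c → norms α ℕ.* (c ℕ.* coefficients α α))
                 (coefficients-≢ {α = β} {α} (same-degree β∈ α∈) (β≢α ∘ sym)))
               (ℕ.*-zeroʳ (norms α)))) ⟩
        ι (z α) * cast (gramTerms α α α)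
          ≈⟨ *-congˡ (cast-≡ (trans (cong (λ c → norms α ℕ.* (c ℕ.* c)) (coefficients-diagonal α)) (ℕ.*-identityʳ (norms α)))) ⟩
        ι (z α) * cast (norms α) ∎
        where
        same-degree : ∀ {β γ} → β ∈ E → γ ∈ E → degree β ≡ degree γ
        same-degree β∈ γ∈ = trans (∈-exponents⁻ β∈) (sym (∈-exponents⁻ γ∈))
        vanish : ∀ q {k} → k ≡ 0 → ι q * cast k ≈ 0#
        vanish q refl = zeroʳ (ι q)

      ι-monomial : ∀ (γ α : Exponent n) → ι (ℚP.monomial γ α) ≈ monomial γ α
      ι-monomial γ α with ≡-dec ℕ._≟_ α γ
      ... | yes _ = ι-1
      ... | no  _ = ι-0

    -- One column of the inverse at a time: the right-hand side is then rational, so the system can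
    -- be solved over ℚ and the solution mapped by `ι`.
    hankel-inverse : ∀ γ → ∃[ z ] ∀ {α} → α ∈ E → ∑ E (λ β → z β * cast (moments (β ⊕ α))) ≈ monomial γ α
    hankel-inverse γ with PositiveDefinite.form-surjective E
      (ℚΣ.cast ∘ norms) (λ γ → cast-pos (norms γ) {{norms-nonZero γ}})
      (ℚΣ.cast ∘ norms) (cast-nonNeg ∘ norms)
      (λ γ α → ℚΣ.cast (coefficients α γ)) rest (ℚP.monomial γ)
    ... | z , z-sol = ι ∘ z , λ {α} α∈ → begin
      ∑ E (λ β → ι (z β) * cast (moments (β ⊕ α)))
        ≈⟨ ∑-cong∈ E (λ {β} β∈ → *-congˡ (∑-gramTerms β α (ℕ.≤-reflexive (∈-exponents⁻ β∈)))) ⟨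
      ∑ E (λ β → ι (z β) * ∑ (below (replicate n m)) (λ δ → cast (gramTerms β α δ)))
        ≈⟨ ∑-cong E (λ β → ∑-* (below (replicate n m)) (ι (z β)) _) ⟨
      ∑ E (λ β → ∑ (below (replicate n m)) (λ δ → ι (z β) * cast (gramTerms β α δ)))
        ≈⟨ ∑-swap E (below (replicate n m)) _ ⟩
      ∑ (below (replicate n m)) (term z α)
        -- `E` is by definition the part of degree m of this same box, and `rest` is its complement.
        ≈⟨ ∑-filter (λ δ → degree δ ℕ.≟ m) (below (replicate n m)) (term z α) ⟩
      ∑ E (term z α) + ∑ rest (term z α)
        ≈⟨ +-congʳ (∑-top-term z α∈) ⟩
      ι (z α) * cast (norms α) + ∑ rest (term z α)
        ≈⟨ ι-form z α rest ⟨
      ι (form rest z α)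
        ≈⟨ ι-cong (z-sol α) ⟩
      ι (ℚP.monomial γ α)
        ≈⟨ ι-monomial γ α ⟩
      monomial γ α ∎

-- Ranks of injective and of surjective linear maps

module Rank {c ℓ} (K : CommutativeRing c ℓ) where
  open LinearAlgebra K

  module _ {m ℓm n ℓn} {V : VectorSpace m ℓm} {W : VectorSpace n ℓn} (f : LinearMap V W) where
    open LinearMap f
    private
      module V = LeftModule V
      module W = LeftModule W

      image-combination : ∀ {r} c (v : Fin r → LeftModule.Carrierᴹ image) →
        proj₁ (combination image c v) W.≈ᴹ combination W c (proj₁ ∘ v)
      image-combination {zero}  c v = W.≈ᴹ-refl
      image-combination {suc r} c v = W.+ᴹ-cong W.≈ᴹ-refl (image-combination (c ∘ suc) (v ∘ suc))

      apply-combination : ∀ {r} c (v : Fin r → V.Carrierᴹ) →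
        apply (combination V c v) W.≈ᴹ combination W c (apply ∘ v)
      apply-combination {zero}  c v = 0ᴹ-homo
      apply-combination {suc r} c v = W.≈ᴹ-trans (+ᴹ-homo _ _)
        (W.+ᴹ-cong (*ₗ-homo (c zero) (v zero)) (apply-combination (c ∘ suc) (v ∘ suc)))

    injective⇒rank : ∀ {r} → HasDimension V r → (∀ x → apply x W.≈ᴹ W.0ᴹ → x V.≈ᴹ V.0ᴹ) →
      LinearAlgebra.LinearMap.HasRank {K = K} f r
    injective⇒rank {r} (v , independent , spanning) injective = b
      , (λ c c·b≈0 → independent c (injective _ (W.≈ᴹ-trans (apply≈ c) c·b≈0)))
      , λ (y , x , fx≈y) → let c , c·v≈x = spanning x in
          c , W.≈ᴹ-trans (W.≈ᴹ-sym (apply≈ c)) (W.≈ᴹ-trans (⟦⟧-cong c·v≈x) fx≈y)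
      where
      b : Fin r → LeftModule.Carrierᴹ image
      b i = apply (v i) , v i , W.≈ᴹ-refl
      apply≈ : ∀ c → apply (combination V c v) W.≈ᴹ proj₁ (combination image c b)
      apply≈ c = W.≈ᴹ-trans (apply-combination c v) (W.≈ᴹ-sym (image-combination c b))

    surjective⇒rank : ∀ {r} → HasDimension W r → (∀ y → ∃[ x ] apply x W.≈ᴹ y) →
      LinearAlgebra.LinearMap.HasRank {K = K} f r
    surjective⇒rank {r} (w , independent , spanning) surjective = b
      , (λ c c·b≈0 → independent c (W.≈ᴹ-trans (W.≈ᴹ-sym (image-combination c b)) c·b≈0))
      , λ (y , _) → let c , c·w≈y = spanning y in c , W.≈ᴹ-trans (image-combination c b) c·w≈y
      where
      b : Fin r → LeftModule.Carrierᴹ image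
      b i = w i , surjective (w i)

lookup-injective : ∀ {a} {A : Set a} {xs : List A} → Unique xs → ∀ i j → List.lookup xs i ≡ List.lookup xs j → i ≡ j
lookup-injective (x∉ ∷ uniq) zero    zero    _  = refl
lookup-injective (x∉ ∷ uniq) zero    (suc j) eq = contradiction eq (All.lookup x∉ (∈-lookup j))
lookup-injective (x∉ ∷ uniq) (suc i) zero    eq = contradiction (sym eq) (All.lookup x∉ (∈-lookup i))
lookup-injective (x∉ ∷ uniq) (suc i) (suc j) eq = cong suc (lookup-injective uniq i j eq)

-- The monomial basis and the growth of dimensions with the degree

module MonomialBasis {c ℓ} (K : CommutativeRing c ℓ) where
  open CommutativeRing K using (_≈_; _*_; 0#; setoid; +-congˡ; *-congˡ; *-identityʳ; zeroʳ)
    renaming (refl to ≈-refl; sym to ≈-sym; trans to ≈-trans)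
  open LinearAlgebra K using (combination; HasDimension)
  open Polynomials K
  open Sums K
  open Exponents K
  open ProductFormulas K
  open import Relation.Binary.Reasoning.Setoid setoid

  combination≈∑ : ∀ {n d r} c (v : Fin r → LeftModule.Carrierᴹ (S d n)) α →
    proj₁ (combination (S d n) c v) α ≈ ∑ (allFin r) (λ i → c i * proj₁ (v i) α)
  combination≈∑ {r = zero}  c v α = ≈-refl
  combination≈∑ {n} {d} {r = suc r} c v α = +-congˡ (≈-trans (combination≈∑ {n} {d} (c ∘ suc) (v ∘ suc) α)
    (≈-sym (∑-tabulate-suc (λ i → c i * proj₁ (v i) α))))

  S-dimension : ∀ n d → LinearAlgebra.HasDimension K (Polynomials.S K d n) (length (Polynomials.exponents K n d))
  S-dimension n d = v , independent , spanning
    where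
    E = exponents n d
    E[_] = List.lookup E
    v : Fin (length E) → LeftModule.Carrierᴹ (S d n)
    v i = monomial E[ i ] , resp-degree {p = monomial E[ i ]} (∈-exponents⁻ {n} {d} (∈-lookup {xs = E} i)) (monomial-hom E[ i ])

    independent : ∀ c → (∀ α → proj₁ (combination (S d n) c v) α ≈ 0#) → ∀ i → c i ≈ 0#
    independent c c·v≈0 i = begin
      c i
        ≈⟨ ≈-trans (*-congˡ (monomial-refl E[ i ])) (*-identityʳ (c i)) ⟨
      c i * monomial E[ i ] E[ i ]
        ≈⟨ ∑-single (Unique.allFin⁺ (length E)) (∈-allFin i) (λ j _ j≢i → ≈-trans (*-congˡ (monomial-≢ E[ j ] E[ i ]
             (j≢i ∘ sym ∘ lookup-injective (exponents-unique n d) i j))) (zeroʳ (c j))) ⟨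
      ∑ (allFin (length E)) (λ j → c j * monomial E[ j ] E[ i ])
        ≈⟨ combination≈∑ {n} {d} c v E[ i ] ⟨
      proj₁ (combination (S d n) c v) E[ i ]
        ≈⟨ c·v≈0 E[ i ] ⟩
      0# ∎

    spanning : ∀ x → ∃[ c ] ∀ α → proj₁ (combination (S d n) c v) α ≈ proj₁ x α
    spanning (p , p-hom) = p ∘ E[_] , λ α → begin
      proj₁ (combination (S d n) (p ∘ E[_]) v) α
        ≈⟨ combination≈∑ {n} {d} (p ∘ E[_]) v α ⟩
      ∑ (allFin (length E)) (λ i → p E[ i ] * monomial E[ i ] α)
        ≈⟨ ∑-map E[_] (allFin (length E)) (λ β → p β * monomial β α) ⟨
      ∑ (List.map E[_] (allFin (length E))) (λ β → p β * monomial β α)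
        ≡⟨ cong (λ xs → ∑ xs (λ β → p β * monomial β α)) (trans (map-tabulate id E[_]) (tabulate-lookup E)) ⟩
      ∑ E (λ β → p β * monomial β α)
        ≈⟨ expand α ⟩
      p α ∎
      where
      expand : ∀ α → ∑ E (λ β → p β * monomial β α) ≈ p α
      expand α with degree α ℕ.≟ d
      ... | yes ∣α∣≡d = ∑-monomial p ∣α∣≡d
      ... | no  ∣α∣≢d = ≈-trans
        (∑-zero E λ {β} β∈ → ≈-trans
          (*-congˡ (monomial-≢ β α λ { refl → ∣α∣≢d (∈-exponents⁻ β∈) })) (zeroʳ (p β)))
        (≈-sym (p-hom α ∣α∣≢d))

  -- Multiplication by x₁^(e - d) embeds the monomials of degree d into those of degree e; this is
  -- where a first variable has to exist.
  length-exponents-mono : ∀ n {d e} → d ≤ e → length (exponents (suc n) d) ≤ length (exponents (suc n) e)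
  length-exponents-mono n {d} {e} d≤e = injective⇒≤ {f = index ∘ raised∈} λ {i} {j} eq →
    lookup-injective (exponents-unique (suc n) d) i j (raise-injective (trans (lookup-index (raised∈ i))
      (trans (cong (List.lookup (exponents (suc n) e)) eq) (sym (lookup-index (raised∈ j))))))
    where
    E = exponents (suc n) d
    raise : Exponent (suc n) → Exponent (suc n)
    raise (a ∷ α) = e ∸ d ℕ.+ a ∷ α
    raise-injective : ∀ {α β} → raise α ≡ raise β → α ≡ β
    raise-injective {a ∷ α} {b ∷ β} eq with ∷-injective eq
    ... | a≡b , refl = cong (_∷ α) (ℕ.+-cancelˡ-≡ (e ∸ d) a b a≡b)
    degree-raise : ∀ α → degree α ≡ d → degree (raise α) ≡ e
    degree-raise (a ∷ α) refl = trans (ℕ.+-assoc (e ∸ d) a (degree α)) (ℕ.m∸n+n≡m d≤e)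
    raised∈ : ∀ i → raise (List.lookup E i) ∈ exponents (suc n) e
    raised∈ i = ∈-exponents⁺ (degree-raise (List.lookup E i) (∈-exponents⁻ {suc n} {d} (∈-lookup {xs = E} i)))

-- Surjectivity, injectivity and rank of the flattenings of `f̃`

module Flattenings {c ℓ} (K : CommutativeRing c ℓ)
  {ι : ℚ → CommutativeRing.Carrier K}
  (ι-isHom : IsRingHomomorphism ℚ.+-*-rawRing (CommutativeRing.rawRing K) ι) where
  open CommutativeRing K renaming (refl to ≈-refl; sym to ≈-sym; trans to ≈-trans) hiding (zero)
  open Polynomials K
  open Sums K
  open Exponents K
  open ProductFormulas K
  open RationalAlgebra K ι-isHom using (cast⁻¹; cast⁻¹-cancel; cast-cancel)
  open Apolarity K ι-isHom
  open Hankel K ι-isHom using (hankel-inverse)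
  open MonomialBasis K using (S-dimension; length-exponents-mono)
  open import Algebra.Properties.Group +-group using (//-rightDividesˡ)
  open import Algebra.Properties.CommutativeSemigroup *-commutativeSemigroup using (x∙yz≈y∙xz)
  open import Relation.Binary.Reasoning.Setoid setoid

  -- A right-hand side with arbitrary scalars is a combination of the unit vectors already solved
  -- over ℚ.
  hankel-surjective : ∀ n m (w : Series n) → ∃[ z ] ∀ {α} → α ∈ exponents n m →
    ∑ (exponents n m) (λ β → z β * cast (moments (β ⊕ α))) ≈ w α
  hankel-surjective n m w = (λ β → ∑ E (λ γ → w γ * z γ β)) , λ {α} α∈ → begin
    ∑ E (λ β → ∑ E (λ γ → w γ * z γ β) * h β α)
      ≈⟨ ∑-cong E (λ β → ∑-*ʳ E (λ γ → w γ * z γ β) (h β α)) ⟨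
    ∑ E (λ β → ∑ E (λ γ → w γ * z γ β * h β α))
      ≈⟨ ∑-swap E E _ ⟩
    ∑ E (λ γ → ∑ E (λ β → w γ * z γ β * h β α))
      ≈⟨ ∑-cong E (λ γ → ≈-trans (∑-cong E λ β → *-assoc (w γ) (z γ β) (h β α)) (∑-* E (w γ) λ β → z γ β * h β α)) ⟩
    ∑ E (λ γ → w γ * ∑ E (λ β → z γ β * h β α))
      ≈⟨ ∑-cong E (λ γ → *-congˡ (proj₂ (hankel-inverse n m γ) α∈)) ⟩
    ∑ E (λ γ → w γ * monomial γ α)
      ≈⟨ ∑-monomial w (∈-exponents⁻ α∈) ⟩
    w α ∎
    where
    E = exponents n m
    h : Exponent n → Exponent n → Carrier
    h β α = cast (moments (β ⊕ α))
    z : Exponent n → Exponent n → Carrier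
    z γ = proj₁ (hankel-inverse n m γ)

  -- Dual to the injectivity of multiplication by x₁ + ⋯ + xₙ.
  antiderivative : ∀ {n} (f : Series (suc n)) →
    ∃[ w ] ∀ γ → ∑ (allFin (suc n)) (λ i → w (updateAt γ i suc)) ≈ f γ
  antiderivative {n} f = uncons , λ { (a ∷ α) → ≈-trans
    (+-congˡ (∑-tabulate-suc (λ i → uncons (updateAt (a ∷ α) i suc)))) (//-rightDividesˡ _ (f (a ∷ α))) }
    where
    w : ℕ → Series n
    -- The values at x₁-exponent 0 are free; the equation at (a, α) then determines the value at (a
    -- + 1, α).
    w zero    α = 0#
    w (suc a) α = f (a ∷ α) - ∑ (allFin n) (λ i → w a (updateAt α i suc))
    uncons : Series (suc n)
    uncons (a ∷ α) = w a α

  module _ (n e s : ℕ) where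
    private
      -- With s = k - e as the parameter, e ≤ k is built in, and the complementary order 2k + 1 - e
      -- becomes s + m.
      k m : ℕ
      k = e ℕ.+ s
      m = suc k
      p : Series (suc n)
      p = f̃-series (suc n) k
      E E′ : List (Exponent (suc n))
      E  = exponents (suc n) m
      E′ = exponents (suc n) (s ℕ.+ m)

      infix 8 _⁺
      _⁺ : Exponent (suc n) → Exponent (suc n)
      (a ∷ α) ⁺ = s ℕ.+ a ∷ α

      degree-⁺ : ∀ α → degree (α ⁺) ≡ s ℕ.+ degree α
      degree-⁺ (a ∷ α) = ℕ.+-assoc s a (degree α)

      -- A factor x₁^s may be moved from the operator to the argument.
      ⁺-⊕ : ∀ β α → β ⁺ ⊕ α ≡ β ⊕ α ⁺
      ⁺-⊕ (b ∷ β) (a ∷ α) = cong (_∷ β ⊕ α) (trans (cong (ℕ._+ a) (ℕ.+-comm s b)) (ℕ.+-assoc b s a))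

      apolar-p : ∀ γ → degree γ ≡ s ℕ.+ m ℕ.+ e →
        cast⁻¹ (k !) {{k ℕ.!≢0}} * (cast 2 * apolar p γ) ≈ ∑ (allFin (suc n)) (λ i → cast (moments (updateAt γ i suc)))
      apolar-p γ ∣γ∣ = ≈-trans (*-congˡ (apolar-f̃ k γ (trans ∣γ∣
        (solve 2 (λ e s → s :+ (con 1 :+ (e :+ s)) :+ e := con 2 :* (e :+ s) :+ con 1) refl e s))))
        (cast⁻¹-cancel (k !) {{k ℕ.!≢0}} _)
        where open +-*-Solver using (solve; _:+_; _:*_; _:=_; con)

    -- The operator D is taken to be divisible by ∂₁^s.
    apolar-surjective : ∀ (f : Series (suc n)) →
      ∃[ D ] Homogeneous (s ℕ.+ m) D × (∀ α → degree α ≡ e → ∑ E′ (λ β → D β * apolar p (β ⊕ α)) ≈ f α)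
    apolar-surjective f = D , D-hom , D-sol
      where
      f⁺ : Series (suc n)
      -- Only the values at exponents α ⁺ are prescribed; where a < s, the truncated subtraction
      -- supplies a default.
      f⁺ (a ∷ α) = f (a ∸ s ∷ α)
      f⁺-⁺ : ∀ α → f⁺ (α ⁺) ≈ f α
      f⁺-⁺ (a ∷ α) = reflexive (cong (λ b → f (b ∷ α)) (ℕ.m+n∸m≡n s a))
      w z : Series (suc n)
      w = proj₁ (antiderivative f⁺)
      z = proj₁ (hankel-surjective (suc n) m w)
      t = cast⁻¹ (k !) {{k ℕ.!≢0}}
      D : Series (suc n)
      -- This is z multiplied by x₁^s; being a sum of monomials, it vanishes wherever x₁^s does not
      -- divide. The scalar t · 2 cancels the constants of `apolar-f̃`.
      D β = ∑ E (λ δ → z δ * (t * cast 2) * monomial (δ ⁺) β)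
      D-hom : Homogeneous (s ℕ.+ m) D
      D-hom β ≢ = ∑-zero E λ {δ} δ∈ → ≈-trans
        (*-congˡ (monomial-≢ (δ ⁺) β λ { refl → ≢ (trans (degree-⁺ δ) (cong (s ℕ.+_) (∈-exponents⁻ δ∈))) }))
        (zeroʳ _)
      D-sol : ∀ α → degree α ≡ e → ∑ E′ (λ β → D β * apolar p (β ⊕ α)) ≈ f α
      D-sol α ∣α∣ = begin
        ∑ E′ (λ β → D β * P β)
          ≈⟨ ∑-cong E′ (λ β → ∑-*ʳ E (λ δ → c′ δ * monomial (δ ⁺) β) (P β)) ⟨
        ∑ E′ (λ β → ∑ E (λ δ → c′ δ * monomial (δ ⁺) β * P β))
          ≈⟨ ∑-swap E′ E _ ⟩
        ∑ E (λ δ → ∑ E′ (λ β → c′ δ * monomial (δ ⁺) β * P β))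
          ≈⟨ ∑-cong∈ E (λ {δ} δ∈ → ≈-trans
               (∑-single (exponents-unique (suc n) (s ℕ.+ m)) (∈-exponents⁺ (∣⁺∣ δ∈)) λ β _ β≢ → ≈-trans
                 (*-congʳ (≈-trans (*-congˡ (monomial-≢ (δ ⁺) β β≢)) (zeroʳ (c′ δ)))) (zeroˡ (P β)))
               (*-congʳ (≈-trans (*-congˡ (monomial-refl (δ ⁺))) (*-identityʳ (c′ δ))))) ⟩
        ∑ E (λ δ → c′ δ * P (δ ⁺))
          ≈⟨ ∑-cong∈ E (λ {δ} δ∈ → ≈-trans (*-assoc (z δ) (t * cast 2) (P (δ ⁺))) (*-congˡ (≈-trans
               (*-assoc t (cast 2) (P (δ ⁺)))
               (apolar-p (δ ⁺ ⊕ α) (trans (degree-⊕ (δ ⁺) α) (cong₂ ℕ._+_ (∣⁺∣ δ∈) ∣α∣)))))) ⟩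
        ∑ E (λ δ → z δ * ∑ (allFin (suc n)) (λ i → cast (moments (updateAt (δ ⁺ ⊕ α) i suc))))
          -- Once x₁^s and the extra variable xᵢ have moved to the right, both indices have degree m
          -- = s + e + 1 and the moment matrix applies.
          ≈⟨ ∑-cong E (λ δ → ≈-trans
               (*-congˡ (∑-cong (allFin (suc n)) λ i → cast-≡ (cong moments (shift δ i))))
               (≈-sym (∑-* (allFin (suc n)) (z δ) _))) ⟩
        ∑ E (λ δ → ∑ (allFin (suc n)) (λ i → z δ * cast (moments (δ ⊕ updateAt (α ⁺) i suc))))
          ≈⟨ ∑-swap E (allFin (suc n)) _ ⟩
        ∑ (allFin (suc n)) (λ i → ∑ E (λ δ → z δ * cast (moments (δ ⊕ updateAt (α ⁺) i suc))))
          ≈⟨ ∑-cong (allFin (suc n)) (λ i → proj₂ (hankel-surjective (suc n) m w) (∈-exponents⁺ (∣α⁺ᵢ∣ i))) ⟩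
        ∑ (allFin (suc n)) (λ i → w (updateAt (α ⁺) i suc))
          ≈⟨ proj₂ (antiderivative f⁺) (α ⁺) ⟩
        f⁺ (α ⁺)
          ≈⟨ f⁺-⁺ α ⟩
        f α ∎
        where
        P : Series (suc n)
        P β = apolar p (β ⊕ α)
        c′ : Series (suc n)
        c′ δ = z δ * (t * cast 2)
        ∣⁺∣ : ∀ {δ} → δ ∈ E → degree (δ ⁺) ≡ s ℕ.+ m
        ∣⁺∣ {δ} δ∈ = trans (degree-⁺ δ) (cong (s ℕ.+_) (∈-exponents⁻ δ∈))
        ∣α⁺ᵢ∣ : ∀ i → degree (updateAt (α ⁺) i suc) ≡ m
        ∣α⁺ᵢ∣ i = trans (degree-suc (α ⁺) i) (cong suc (trans (degree-⁺ α) (trans (cong (s ℕ.+_) ∣α∣) (ℕ.+-comm s e))))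
        shift : ∀ δ i → updateAt (δ ⁺ ⊕ α) i suc ≡ δ ⊕ updateAt (α ⁺) i suc
        shift δ i = trans (cong (λ γ → updateAt γ i suc) (⁺-⊕ δ α)) (updateAt-⊕ i δ (α ⁺))

    -- Let C of order s + m solve the complementary system for the unit vector at α. The pairing of
    -- D with C through p, summed over C first, gives the coefficient of D at α; summed over D
    -- first, it gives 0 because D annihilates p.
    flattening-injective : ∀ {D} → Homogeneous e D → (∀ β → differentiate e D p β ≈ 0#) → ∀ α → D α ≈ 0#
    flattening-injective {D} D-hom Dp≈0 α with degree α ℕ.≟ e
    ... | no  ∣α∣≢e = D-hom α ∣α∣≢e
    ... | yes ∣α∣≡e = begin
      D α
        ≈⟨ ≈-trans (*-congˡ (monomial-refl α)) (*-identityʳ (D α)) ⟨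
      D α * monomial α α
        ≈⟨ ∑-single (exponents-unique (suc n) e) (∈-exponents⁺ ∣α∣≡e) (λ β _ β≢α →
             ≈-trans (*-congˡ (monomial-≢ α β β≢α)) (zeroʳ (D β))) ⟨
      ∑ Es (λ β → D β * monomial α β)
        ≈⟨ ∑-cong∈ Es (λ {β} β∈ → *-congˡ (C-sol β (∈-exponents⁻ β∈))) ⟨
      ∑ Es (λ β → D β * ∑ E′ (λ γ → C γ * apolar p (γ ⊕ β)))
        ≈⟨ ∑-cong Es (λ β → ∑-* E′ (D β) _) ⟨
      ∑ Es (λ β → ∑ E′ (λ γ → D β * (C γ * apolar p (γ ⊕ β))))
        ≈⟨ ∑-swap Es E′ _ ⟩
      ∑ E′ (λ γ → ∑ Es (λ β → D β * (C γ * apolar p (γ ⊕ β))))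
        ≈⟨ ∑-zero E′ (λ {γ} _ → vanish γ) ⟩
      0# ∎
      where
      Es = exponents (suc n) e
      C = proj₁ (apolar-surjective (monomial α))
      C-sol = proj₂ (proj₂ (apolar-surjective (monomial α)))
      vanish : ∀ γ → ∑ Es (λ β → D β * (C γ * apolar p (γ ⊕ β))) ≈ 0#
      vanish γ = begin
        ∑ Es (λ β → D β * (C γ * apolar p (γ ⊕ β)))
          ≈⟨ ∑-cong Es (λ β → ≈-trans (x∙yz≈y∙xz (D β) (C γ) _)
               (*-congˡ (*-congˡ (reflexive (cong (apolar p) (⊕-comm γ β)))))) ⟩
        ∑ Es (λ β → C γ * (D β * apolar p (β ⊕ γ)))
          ≈⟨ ∑-* Es (C γ) _ ⟩
        C γ * ∑ Es (λ β → D β * apolar p (β ⊕ γ))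
          ≈⟨ *-congˡ (apolar-differentiate e D p γ) ⟨
        C γ * apolar (differentiate e D p) γ
          ≈⟨ *-congˡ (≈-trans (*-congˡ (Dp≈0 γ)) (zeroʳ _)) ⟩
        C γ * 0#
          ≈⟨ zeroʳ (C γ) ⟩
        0# ∎

    flattening-surjective : ∀ (f : Series (suc n)) →
      ∃[ D ] Homogeneous (s ℕ.+ m) D × (∀ α → degree α ≡ e → differentiate (s ℕ.+ m) D p α ≈ f α)
    flattening-surjective f = let D , D-hom , D-sol = apolar-surjective (apolar f) in
      D , D-hom , λ α ∣α∣ → cast-cancel (factorials α) {{factorials-nonZero α}}
        (≈-trans (apolar-differentiate (s ℕ.+ m) D p α) (D-sol α ∣α∣))

  -- The degree 2k + 1 is odd, so exactly one of e and 2k + 1 - e is at most k; comparing dimensions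
  -- shows that this one gives the minimum.
  f̃-injective-or-surjective : ∀ n k e → e ≤ 2 ℕ.* k ℕ.+ 1 →
    let p = f̃-series (suc n) k
        a = length (exponents (suc n) e)
        b = length (exponents (suc n) (2 ℕ.* k ℕ.+ 1 ∸ e)) in
    (a ≤ b × (∀ {D} → Homogeneous e D → (∀ α → differentiate e D p α ≈ 0#) → ∀ α → D α ≈ 0#)) ⊎
    (b ≤ a × (∀ {q} → Homogeneous (2 ℕ.* k ℕ.+ 1 ∸ e) q →
              ∃[ D ] Homogeneous e D × (∀ α → differentiate e D p α ≈ q α)))
  f̃-injective-or-surjective n k e e≤2k+1 with e ℕ.≤? k
  ... | yes e≤k with ℕ.m≤n⇒∃[o]m+o≡n e≤k
  ...   | s , refl = inj₁ (length-exponents-mono n e≤d-e , flattening-injective n e s)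
    where
    e≤d-e : e ≤ 2 ℕ.* (e ℕ.+ s) ℕ.+ 1 ∸ e
    e≤d-e = ℕ.m+n≤o⇒m≤o∸n e (ℕ.≤-trans
      (ℕ.+-mono-≤ e≤k (ℕ.≤-trans e≤k (ℕ.≤-reflexive (sym (ℕ.+-identityʳ (e ℕ.+ s))))))
      (ℕ.m≤m+n (2 ℕ.* (e ℕ.+ s)) 1))
  f̃-injective-or-surjective n k e e≤2k+1 | no e≰k with complementary
    where
    -- Here e′ = 2k + 1 - e is the degree of the target. It is at most k and takes the role of the
    -- small order, with s = k - e′.
    complementary : ∃[ s ] ∃[ e′ ] e′ ℕ.+ s ≡ k × s ℕ.+ suc k ≡ e
    complementary with ℕ.m≤n⇒∃[o]m+o≡n (ℕ.≰⇒> e≰k)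
    ... | s , refl with ℕ.m≤n⇒∃[o]m+o≡n (ℕ.+-cancelˡ-≤ (suc k) s k (ℕ.≤-trans e≤2k+1
      (ℕ.≤-reflexive (solve 1 (λ k → con 2 :* k :+ con 1 := con 1 :+ k :+ k) refl k))))
      where open +-*-Solver using (solve; _:+_; _:*_; _:=_; con)
    ...   | e′ , refl = s , e′ , ℕ.+-comm e′ s , ℕ.+-comm s (suc (s ℕ.+ e′))
  ... | s , e′ , refl , refl = inj₂ (length-exponents-mono n d-e≤e , surjective)
    where
    d-e≡e′ : 2 ℕ.* k ℕ.+ 1 ∸ e ≡ e′
    d-e≡e′ = trans
      (cong (_∸ e) (solve 2 (λ e′ s → con 2 :* (e′ :+ s) :+ con 1 := s :+ (con 1 :+ (e′ :+ s)) :+ e′) refl e′ s))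
      (ℕ.m+n∸m≡n e e′)
      where open +-*-Solver using (solve; _:+_; _:*_; _:=_; con)
    d-e≤e : 2 ℕ.* k ℕ.+ 1 ∸ e ≤ e
    d-e≤e = ℕ.≤-trans (ℕ.≤-reflexive d-e≡e′)
      (ℕ.≤-trans (ℕ.≤-trans (ℕ.m≤m+n e′ s) (ℕ.n≤1+n k)) (ℕ.m≤n+m (suc k) s))
    surjective : ∀ {q} → Homogeneous (2 ℕ.* k ℕ.+ 1 ∸ e) q →
                 ∃[ D ] Homogeneous e D × (∀ α → differentiate e D (f̃-series (suc n) k) α ≈ q α)
    surjective {q} q-hom = D , D-hom , Dp≈q′
      where
      D = proj₁ (flattening-surjective n e′ s q)
      D-hom = proj₁ (proj₂ (flattening-surjective n e′ s q))
      Dp≈q = proj₂ (proj₂ (flattening-surjective n e′ s q))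
      Dp≈q′ : ∀ α → differentiate e D (f̃-series (suc n) k) α ≈ q α
      -- The construction controls only the coefficients of degree e′; in all other degrees both
      -- sides vanish by homogeneity.
      Dp≈q′ α with degree α ℕ.≟ 2 ℕ.* k ℕ.+ 1 ∸ e
      ... | yes ∣α∣≡ = Dp≈q α (trans ∣α∣≡ d-e≡e′)
      ... | no  ∣α∣≢ = ≈-trans (differentiate-hom e {D} D-hom (proj₂ (f̃ (suc n) k)) α ∣α∣≢) (≈-sym (q-hom α ∣α∣≢))

  f̃-rank : ∀ n k e → e ≤ 2 ℕ.* k ℕ.+ 1 → LinearAlgebra.LinearMap.HasRank {K = K}
    (Polynomials.flattening K (Polynomials.f̃ K (suc n) k) e)
    (length (Polynomials.exponents K (suc n) e) ℕ.⊓ length (Polynomials.exponents K (suc n) (2 ℕ.* k ℕ.+ 1 ∸ e)))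
  f̃-rank n k e e≤2k+1 = [ rank-a , rank-b ]′ (f̃-injective-or-surjective n k e e≤2k+1)
    where
    φ = Polynomials.flattening K (Polynomials.f̃ K (suc n) k) e
    a = length (Polynomials.exponents K (suc n) e)
    b = length (Polynomials.exponents K (suc n) (2 ℕ.* k ℕ.+ 1 ∸ e))
    rank-a = λ (a≤b , injective) → subst (LinearAlgebra.LinearMap.HasRank {K = K} φ) (sym (ℕ.m≤n⇒m⊓n≡m {a} {b} a≤b))
      (Rank.injective⇒rank K φ (S-dimension (suc n) e) λ (D , D-hom) → injective D-hom)
    rank-b = λ (b≤a , surjective) → subst (LinearAlgebra.LinearMap.HasRank {K = K} φ) (sym (ℕ.m≥n⇒m⊓n≡n {a} {b} b≤a))
      (Rank.surjective⇒rank K φ (S-dimension (suc n) (2 ℕ.* k ℕ.+ 1 ∸ e)) λ (q , q-hom) →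
        let D , D-hom , Dp≈q = surjective q-hom in (D , D-hom) , Dp≈q)

-- Specialisation to ℂ

open import Data.Nat using (ℕ; _≤_; _+_; _*_; _∸_; _⊓_)
open import Data.Product using (∃-syntax; _×_)
open import Defs using (HasDimension; LinearMap; S; S*; flattening; f̃; ℂ-commutativeRing; constℂ; mk≈ℂ; pointwise)

constℂ-isHom : IsRingHomomorphism ℚ.+-*-rawRing (CommutativeRing.rawRing ℂ-commutativeRing) constℂ
constℂ-isHom = record
  { isSemiringHomomorphism = record
    { isNearSemiringHomomorphism = record
      { +-isMonoidHomomorphism = record
        { isMagmaHomomorphism = record
          { isRelHomomorphism = record { cong = λ { refl → CommutativeRing.refl ℂ-commutativeRing } }
          ; homo = λ p q → mk≈ℂ (pointwise λ _ → refl) (pointwise λ _ → refl)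
          }
        ; ε-homo = CommutativeRing.refl ℂ-commutativeRing
        }
      ; *-homo = λ p q → mk≈ℂ
          (pointwise λ _ → sym (ℚ.+-identityʳ (p ℚ.* q)))
          (pointwise λ _ → sym (cong₂ ℚ._+_ (ℚ.*-zeroʳ p) (ℚ.*-zeroˡ q)))
      }
    ; 1#-homo = CommutativeRing.refl ℂ-commutativeRing
    }
  ; -‿homo = λ p → mk≈ℂ (pointwise λ _ → refl) (pointwise λ _ → refl)
  }

-- The names exported by Defs are definitionally those of Polynomials and LinearAlgebra at ℂ, but
-- converting ranks between them directly unfolds the proofs of the ring laws of ℂ; transport does not.
f̃-≡ : ∀ n k → Polynomials.f̃ ℂ-commutativeRing n k ≡ f̃ n k
f̃-≡ n k = refl

flattening-≡ : ∀ {n d} e {p q : LeftModule.Carrierᴹ (Polynomials.S ℂ-commutativeRing d n)} → p ≡ q →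
               Polynomials.flattening ℂ-commutativeRing {n} {d} p e ≡ flattening {n} {d} q e
flattening-≡ e refl = refl

rank-resp-≡ : ∀ {n d e r}
  {f g : LinearMap (Polynomials.S* ℂ-commutativeRing e n) (Polynomials.S ℂ-commutativeRing d n)} → f ≡ g →
  LinearAlgebra.LinearMap.HasRank {K = ℂ-commutativeRing} f r → LinearMap.HasRank g r
rank-resp-≡ refl rank = rank

theorem7 : ∀ (n k e : ℕ) → 1 ≤ n → e ≤ 2 * k + 1 →
    ∃[ a ] ∃[ b ] HasDimension (S* e n) a
    × HasDimension (S (2 * k + 1 ∸ e) n) b
    × LinearMap.HasRank (flattening (f̃ n k) e) (a ⊓ b)
theorem7 (suc n) k e _ e≤2k+1 = _ , _ , S-dimension (suc n) e , S-dimension (suc n) (2 * k + 1 ∸ e) , rank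
  where
  open MonomialBasis ℂ-commutativeRing using (S-dimension)
  open Flattenings ℂ-commutativeRing constℂ-isHom using (f̃-rank)
  rank = rank-resp-≡ {suc n} {2 * k + 1 ∸ e} {e} (flattening-≡ {suc n} {2 * k + 1} e (f̃-≡ (suc n) k)) (f̃-rank n k e e≤2k+1)
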